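{- Let $G$ be a finite simple graph, $\theta$ a real number and $X\subseteq V(G)$ with $|X|>1$. Then $X$ is a $\theta$-extreme set if and only if $X$ is $\theta$-nice.
   Context: $\mu(G,x)=\sum_{r\ge 0}(-1)^r p(G,r)x^{|V(G)|-2r}$ is the matching polynomial ($p(G,r)$ = number of $r$-matchings, $p(G,0)=1$, empty graph has $\mu=1$); $\textnormal{mult}(\theta,G)$ is the multiplicity of $\theta$ as a root of $\mu(G,x)$ ($0$ if not a root). $G\setminus X$, $G\setminus uv$ denote vertex deletion. $X$ is $\theta$-extreme if $\textnormal{mult}(\theta,G\setminus X)=\textnormal{mult}(\theta,G)+|X|$; a set $X$ with $|X|>1$ is $\theta$-nice if $\textnormal{mult}(\theta,G\setminus uv)=\textnormal{mult}(\theta,G)+2$ for all distinct $u,v\in X$. -}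

module Defs where

open import Level using (Level; _⊔_) renaming (suc to lsuc)
open import Algebra.Bundles using (CommutativeRing)
open import Relation.Binary.Core using (Rel)
open import Relation.Binary.Structures using (IsStrictTotalOrder)
open import Relation.Nullary using (¬_)
open import Data.Product using (Σ; ∃; _×_; _,_)
open import Data.Sum using (_⊎_)
open import Data.Unit.Polymorphic using (⊤)
open import Data.Bool using (Bool; true; false; _∧_; if_then_else_)
open import Data.Nat as ℕ using (ℕ; zero; suc; _∸_; ⌊_/2⌋; _≡ᵇ_; _<ᵇ_)
open import Data.Fin using (Fin; toℕ)
open import Data.Fin.Subset using (Subset; ∁; _∪_; ⁅_⁆; ∣_∣) renaming (⊤ to Full)
open import Data.Vec using (lookup)
open import Data.List using (List; []; _∷_; [_]; map; _++_; filter; length; concatMap; allFin; upTo; foldr; replicate)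
open import Relation.Binary.PropositionalEquality using (_≡_)
open import Relation.Nullary.Decidable using (T?)
open import Data.Bool using (T)

-- The real numbers, axiomatised as a Dedekind-complete ordered field
-- (unique up to isomorphism).

record RealNumbers (c ℓ : Level) : Set (lsuc (c ⊔ ℓ)) where
  field
    commRing : CommutativeRing c ℓ
  open CommutativeRing commRing public
  field
    _<_                : Rel Carrier ℓ
    isStrictTotalOrder : IsStrictTotalOrder _≈_ _<_
    +-mono-<           : ∀ {x y} z → x < y → (x + z) < (y + z)
    *-pos              : ∀ {x y} → 0# < x → 0# < y → 0# < (x * y)
    0<1                : 0# < 1#
    inverse            : ∀ x → ¬ (x ≈ 0#) → ∃ λ y → (x * y) ≈ 1#

  _≤ℝ_ : Rel Carrier ℓ
  x ≤ℝ y = (x < y) ⊎ (x ≈ y)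

  IsUpperBound : (Carrier → Set ℓ) → Carrier → Set (c ⊔ ℓ)
  IsUpperBound P b = ∀ x → P x → x ≤ℝ b

  field
    sup : (P : Carrier → Set ℓ) → ∃ P → ∃ (IsUpperBound P) →
          ∃ λ s → IsUpperBound P s × (∀ b → IsUpperBound P b → s ≤ℝ b)

record Graph (n : ℕ) : Set where
  field
    adj    : Fin n → Fin n → Bool
    sym    : ∀ i j → adj i j ≡ adj j i
    irrefl : ∀ i → adj i i ≡ false
open Graph public

Edge : ℕ → Set
Edge n = Fin n × Fin n

edges : ∀ {n} → Graph n → Subset n → List (Edge n)
edges {n} G S =
  concatMap (λ i → concatMap (λ j →
     if (toℕ i <ᵇ toℕ j) ∧ lookup S i ∧ lookup S j ∧ adj G i j
     then [ (i , j) ] else []) (allFin n)) (allFin n)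

sublists : ∀ {a} {A : Set a} → List A → List (List A)
sublists []       = [] ∷ []
sublists (x ∷ xs) = map (x ∷_) (sublists xs) ++ sublists xs

_==_ : ∀ {n} → Fin n → Fin n → Bool
i == j = toℕ i ≡ᵇ toℕ j

not : Bool → Bool
not true = false
not false = true

disjointᵇ : ∀ {n} → Edge n → Edge n → Bool
disjointᵇ (a , b) (c , d) = not ((a == c) Data.Bool.∨ (a == d) Data.Bool.∨ (b == c) Data.Bool.∨ (b == d))

allᵇ : ∀ {a} {A : Set a} → (A → Bool) → List A → Bool
allᵇ f []       = true
allᵇ f (x ∷ xs) = f x ∧ allᵇ f xs

isMatchingᵇ : ∀ {n} → List (Edge n) → Bool
isMatchingᵇ []       = true
isMatchingᵇ (e ∷ es) = allᵇ (disjointᵇ e) es ∧ isMatchingᵇ es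

numMatchings : ∀ {n} → Graph n → Subset n → ℕ → ℕ
numMatchings G S r =
  length (filter (λ m → T? (isMatchingᵇ m ∧ (length m ≡ᵇ r))) (sublists (edges G S)))

module _ {c ℓ} (ℝ : RealNumbers c ℓ) where
  open RealNumbers ℝ

  -- polynomials as coefficient lists, lowest degree first
  Poly : Set c
  Poly = List Carrier

  _+ₚ_ : Poly → Poly → Poly
  []       +ₚ q        = q
  (a ∷ p)  +ₚ []       = a ∷ p
  (a ∷ p)  +ₚ (b ∷ q)  = (a + b) ∷ (p +ₚ q)

  _*ₚ_ : Poly → Poly → Poly
  []      *ₚ q = []
  (a ∷ p) *ₚ q = map (a *_) q +ₚ (0# ∷ (p *ₚ q))

  data _≈ₚ_ : Poly → Poly → Set (c ⊔ ℓ) where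
    []≈[] : [] ≈ₚ []
    []≈∷  : ∀ {b q} → b ≈ 0# → [] ≈ₚ q → [] ≈ₚ (b ∷ q)
    ∷≈[]  : ∀ {a p} → a ≈ 0# → p ≈ₚ [] → (a ∷ p) ≈ₚ []
    ∷≈∷   : ∀ {a b p q} → a ≈ b → p ≈ₚ q → (a ∷ p) ≈ₚ (b ∷ q)

  _^ₚ_ : Poly → ℕ → Poly
  p ^ₚ zero  = 1# ∷ []
  p ^ₚ suc k = p *ₚ (p ^ₚ k)

  _∣ₚ_ : Poly → Poly → Set (c ⊔ ℓ)
  f ∣ₚ g = ∃ λ q → g ≈ₚ (f *ₚ q)

  X-θ : Carrier → Poly
  X-θ θ = (- θ) ∷ 1# ∷ []

  -- θ is a root of p of multiplicity exactly k  (k = 0 if not a root)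
  Mult : Carrier → Poly → ℕ → Set (c ⊔ ℓ)
  Mult θ p k = ((X-θ θ ^ₚ k) ∣ₚ p) × ¬ ((X-θ θ ^ₚ suc k) ∣ₚ p)

  fromℕ : ℕ → Carrier
  fromℕ zero    = 0#
  fromℕ (suc m) = 1# + fromℕ m

  sign : ℕ → Carrier
  sign zero    = 1#
  sign (suc r) = - sign r

  monomial : Carrier → ℕ → Poly
  monomial a k = replicate k 0# ++ [ a ]

  μ : ∀ {n} → Graph n → Subset n → Poly
  μ G S = foldr _+ₚ_ []
    (map (λ r → monomial (sign r * fromℕ (numMatchings G S r)) (∣ S ∣ ∸ (2 ℕ.* r)))
         (upTo (suc ⌊ ∣ S ∣ /2⌋)))

  -- G \ X is the induced subgraph on ∁ X; G itself is G[Full]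

  IsExtreme : ∀ {n} → Graph n → Carrier → Subset n → Set (c ⊔ ℓ)
  IsExtreme G θ X = ∃ λ k → Mult θ (μ G Full) k × Mult θ (μ G (∁ X)) (k ℕ.+ ∣ X ∣)

  IsNice : ∀ {n} → Graph n → Carrier → Subset n → Set (c ⊔ ℓ)
  IsNice G θ X = ∀ u v → u Data.Fin.Subset.∈ X → v Data.Fin.Subset.∈ X → ¬ (u ≡ v) →
    ∃ λ k → Mult θ (μ G Full) k × Mult θ (μ G (∁ (⁅ u ⁆ ∪ ⁅ v ⁆))) (k ℕ.+ 2)

{-# OPTIONS --safe #-}

-- The recurrence μ(S) = x μ(S−u) − Σ_{w∼u} μ(S−u−w) (u ∈ S) gives two facts.
--
-- Interlacing: near θ the germ of μ(S−u)/μ(S) is either a simple pole with positive residue or regular with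
-- negative derivative, because this dichotomy passes from the ratios μ(S−u−w)/μ(S−u) to 1/(x − Σ …).  Hence
-- deleting a vertex changes mult(θ) by at most one, and extreme sets are nice.
--
-- Heilmann–Lieb: μ(S−u) μ(S−v) − μ(S) μ(S−u−v) is a sum of squares, so it vanishes at θ to even order.  This
-- holds for arbitrary vertex weights, in particular when the weight of one vertex w is raised by 1, which
-- replaces μ(S) by μ(S) + μ(S−w).  If mult grows by 1 on each of u, v, w and by 2 on each pair, then a growth
-- by 2 on the triple gives an odd order for the pair u, v in S−w, and a growth by 1 gives an odd order for the
-- pair u, v in S with the raised weight.  So the triple grows by 3, i.e. X−w is nice in G−w, and a nice set
-- is extreme by induction on its size.

module Submission where

open import Defs renaming (sym to adj-sym)
open import Level using (Level; _⊔_)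
open import Algebra.Bundles using (CommutativeRing)
import Algebra.Properties.CommutativeMonoid.Sum
import Algebra.Properties.Ring
import Algebra.Solver.Ring.NaturalCoefficients.Default
open import Data.Bool as Bool using (Bool; true; false; _∧_; _∨_; if_then_else_)
open import Data.Bool.Properties using (∧-zeroʳ; ∧-identityʳ; ∧-comm; ∧-assoc)
open import Data.Fin using (Fin; zero; suc; toℕ)
import Data.Fin.Properties as Fin
open import Data.Fin.Subset using (Subset; ∣_∣; ∁; ⁅_⁆; _∪_) renaming (⊤ to Full)
open import Data.Fin.Subset.Properties using (∣p∣≤n)
open import Data.List using (List; []; _∷_; [_]; map; _++_; filterᵇ; length; concatMap; allFin; tabulate; foldr; applyUpTo)
open import Data.List.Properties using (filter-++; length-++; length-filter; concatMap-cong)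
open import Data.Nat as ℕ using (ℕ; zero; suc; _∸_; ⌊_/2⌋; _≡ᵇ_; _<ᵇ_; z≤n; s≤s)
import Data.Nat.Properties as ℕ
open import Data.Nat.Solver using (module +-*-Solver)
open import Data.Product using (∃; ∃₂; _×_; _,_; proj₁; proj₂)
open import Data.Sum using (_⊎_; inj₁; inj₂)
open import Data.Vec using (lookup; _[_]≔_; []; _∷_)
open import Data.Vec.Properties using ([]≔-idempotent; []≔-commutes; lookup∘updateAt; lookup∘updateAt′; []=⇒lookup; lookup⇒[]=; lookup-map; lookup-zipWith; lookup-replicate; tabulate∘lookup; tabulate-cong)
open import Function using (_∘_; id)
open import Function.Bundles using (_⇔_; mk⇔)
open import Relation.Binary.Definitions using (tri<; tri≈; tri>)
open import Relation.Binary.PropositionalEquality as ≡ using (_≡_; _≢_; _≗_)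
import Relation.Binary.Reasoning.Setoid
open import Relation.Binary.Structures using (IsStrictTotalOrder)
open import Relation.Nullary using (¬_; contradiction; yes; no; does)

-- The dichotomy for μ(S-u)/μ(S) is the trace at θ of a partial fraction expansion with positive
-- residues; such functions are stable under addition and under s ↦ 1/(x - s). An empty neighbour
-- sum is 0, with derivative 0, so sums only satisfy the weak sign condition `NonNegative`; the
-- derivative 1 of x restores the strict one, `Positive`. The weight of w is raised because the pair
-- u, v in S shows no conflict by itself: with k = mult(S) the two products have orders k + (k+2)
-- and (k+1) + (k+1), both even, and the triple does not occur in them. Adding μ(S-w), μ(S-u-w),
-- μ(S-v-w) leaves the orders k, k+1, k+1 alone, but adding a μ(S-u-v-w) of order k+1 lowers k+2 to
-- k+1. The first product then has the odd order 2k+1, which the second is too small to cancel.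

private
  variable
    n : ℕ

-- Vertex deletion

infixl 6 _⊝_

_⊝_ : Subset n → Fin n → Subset n
S ⊝ u = S [ u ]≔ false

⊝-comm : ∀ (S : Subset n) {u v} → u ≢ v → S ⊝ u ⊝ v ≡ S ⊝ v ⊝ u
⊝-comm S {u} {v} = []≔-commutes S u v

⊝-removed : ∀ (S : Subset n) u → lookup (S ⊝ u) u ≡ false
⊝-removed S u = lookup∘updateAt u S

⊝-kept : ∀ (S : Subset n) {u v} → v ≢ u → lookup (S ⊝ u) v ≡ lookup S v
⊝-kept S {u} {v} v≢u = lookup∘updateAt′ v u v≢u S

⊝-absent : ∀ (S : Subset n) u {v} → lookup S v ≡ false → lookup (S ⊝ u) v ≡ false
⊝-absent S u {v} Sv with v Fin.≟ u
... | yes ≡.refl = ⊝-removed S u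
... | no v≢u     = ≡.trans (⊝-kept S v≢u) Sv

lookup-delete : ∀ (S : Subset n) u i → lookup (S ⊝ u) i ≡ lookup S i ∧ not (i == u)
lookup-delete (s ∷ S) zero    zero    = ≡.sym (∧-zeroʳ s)
lookup-delete (s ∷ S) zero    (suc i) = ≡.sym (∧-identityʳ _)
lookup-delete (s ∷ S) (suc u) zero    = ≡.sym (∧-identityʳ s)
lookup-delete (s ∷ S) (suc u) (suc i) = lookup-delete S u i

∣delete∣ : ∀ (S : Subset n) u → lookup S u ≡ true → ∣ S ∣ ≡ suc ∣ S ⊝ u ∣
∣delete∣ (true  ∷ S) zero    _  = ≡.refl
∣delete∣ (true  ∷ S) (suc u) Su = ≡.cong suc (∣delete∣ S u Su)
∣delete∣ (false ∷ S) (suc u) Su = ∣delete∣ S u Su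

empty-or-member : ∀ (S : Subset n) → (∀ i → lookup S i ≡ false) ⊎ ∃ λ u → lookup S u ≡ true
empty-or-member []          = inj₁ λ ()
empty-or-member (true  ∷ S) = inj₂ (zero , ≡.refl)
empty-or-member (false ∷ S) with empty-or-member S
... | inj₁ none     = inj₁ λ { zero → ≡.refl ; (suc i) → none i }
... | inj₂ (u , Su) = inj₂ (suc u , Su)

∣empty∣ : ∀ (S : Subset n) → (∀ i → lookup S i ≡ false) → ∣ S ∣ ≡ 0
∣empty∣ []          none = ≡.refl
∣empty∣ (true  ∷ S) none = contradiction (none zero) λ ()
∣empty∣ (false ∷ S) none = ∣empty∣ S (none ∘ suc)

-- Set difference as a relation, so that an induction can keep `S′` fixed while it deletes the same
-- vertex from `S` and from `Y`.
Removes : Subset n → Subset n → Subset n → Set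
Removes S Y S′ = ∀ i → lookup S′ i ≡ lookup S i ∧ Bool.not (lookup Y i)

Removes-⊝ : ∀ (S Y S′ : Subset n) w → lookup Y w ≡ true → Removes S Y S′ → Removes (S ⊝ w) (Y ⊝ w) S′
Removes-⊝ S Y S′ w Yw rem i with i Fin.≟ w
... | yes ≡.refl rewrite rem i | Yw | ⊝-removed S i = ∧-zeroʳ (lookup S i)
... | no i≢w rewrite ⊝-kept S i≢w | ⊝-kept Y i≢w = rem i

lookup-ext : ∀ {S T : Subset n} → (∀ i → lookup S i ≡ lookup T i) → S ≡ T
lookup-ext {S = S} {T} h = ≡.trans (≡.sym (tabulate∘lookup S)) (≡.trans (tabulate-cong h) (tabulate∘lookup T))

Removes-none : ∀ (S Y S′ : Subset n) → (∀ i → lookup Y i ≡ false) → Removes S Y S′ → S′ ≡ S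
Removes-none S Y S′ none rem = lookup-ext λ i → ≡.trans (rem i) (lemma i)
  where
  lemma : ∀ i → lookup S i ∧ Bool.not (lookup Y i) ≡ lookup S i
  lemma i rewrite none i with lookup S i
  ... | true  = ≡.refl
  ... | false = ≡.refl

∈-⊝ : ∀ (Y : Subset n) {w u} → lookup (Y ⊝ w) u ≡ true → u ≢ w × lookup Y u ≡ true
∈-⊝ Y {w} {u} h with u Fin.≟ w
... | yes ≡.refl = contradiction (≡.trans (≡.sym h) (⊝-removed Y u)) λ ()
... | no u≢w     = u≢w , ≡.trans (≡.sym (⊝-kept Y u≢w)) h

Includes : Subset n → Subset n → Set
Includes S Y = ∀ i → lookup Y i ≡ true → lookup S i ≡ true

Includes-⊝ : ∀ (S Y : Subset n) w → Includes S Y → Includes (S ⊝ w) (Y ⊝ w)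
Includes-⊝ S Y w inc i Yi with i≢w , Yi′ ← ∈-⊝ Y Yi = ≡.trans (⊝-kept S i≢w) (inc i Yi′)

Full-includes : ∀ (Y : Subset n) → Includes Full Y
Full-includes Y i _ = lookup-replicate i true

∁-removes : ∀ (Y : Subset n) → Removes Full Y (∁ Y)
∁-removes {n} Y i rewrite lookup-replicate {n = n} i true = lookup-map i Bool.not Y

∁-pair : ∀ (u v : Fin n) → ∁ (⁅ u ⁆ ∪ ⁅ v ⁆) ≡ Full ⊝ u ⊝ v
∁-pair {n} u v = lookup-ext pointwise
  where
  lookup-⁅⁆ : ∀ {n} (u i : Fin n) → lookup ⁅ u ⁆ i ≡ (i == u)
  lookup-⁅⁆ zero    zero    = ≡.refl
  lookup-⁅⁆ zero    (suc i) = lookup-replicate i false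
  lookup-⁅⁆ (suc u) zero    = ≡.refl
  lookup-⁅⁆ (suc u) (suc i) = lookup-⁅⁆ u i
  pointwise : ∀ i → lookup (∁ (⁅ u ⁆ ∪ ⁅ v ⁆)) i ≡ lookup (Full ⊝ u ⊝ v) i
  pointwise i rewrite lookup-map i Bool.not (⁅ u ⁆ ∪ ⁅ v ⁆) | lookup-zipWith _∨_ i ⁅ u ⁆ ⁅ v ⁆
    | lookup-⁅⁆ u i | lookup-⁅⁆ v i | lookup-delete (Full ⊝ u) v i | lookup-delete Full u i
    | lookup-replicate {n = n} i true
    with i == u | i == v
  ... | true  | true  = ≡.refl
  ... | true  | false = ≡.refl
  ... | false | true  = ≡.refl
  ... | false | false = ≡.refl

-- Counting matchings

module Matchings where
  open import Data.Nat using (_+_; _*_; _≤_; _<_)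
  open import Data.Nat.Properties using (+-identityʳ; +-assoc; +-comm; +-suc; ≤-refl; ≤-trans; ≤-pred; <-trans; n<1+n; suc-injective)
  open ≡ using (refl; sym; trans; cong; cong₂; subst; module ≡-Reasoning)
  open Algebra.Properties.CommutativeMonoid.Sum ℕ.+-0-commutativeMonoid using (sum; sum-cong-≗; ∑-distrib-+; ∑-comm; sum-replicate-zero)

  private
    variable
      a b : Level
      A : Set a
      B : Set b

  count : (A → Bool) → List A → ℕ
  count p xs = length (filterᵇ p xs)

  count-++ : ∀ (p : A → Bool) xs ys → count p (xs ++ ys) ≡ count p xs + count p ys
  count-++ p xs ys = trans (cong length (filter-++ _ xs ys)) (length-++ (filterᵇ p xs))

  count-map : ∀ (p : B → Bool) (f : A → B) xs → count p (map f xs) ≡ count (p ∘ f) xs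
  count-map p f [] = refl
  count-map p f (x ∷ xs) with p (f x)
  ... | true  = cong suc (count-map p f xs)
  ... | false = count-map p f xs

  filterᵇ-cong : ∀ {p q : A → Bool} → p ≗ q → filterᵇ p ≗ filterᵇ q
  filterᵇ-cong p≗q [] = refl
  filterᵇ-cong {p = p} {q} p≗q (x ∷ xs) with p x | q x | p≗q x
  ... | true  | .true  | refl = cong (x ∷_) (filterᵇ-cong p≗q xs)
  ... | false | .false | refl = filterᵇ-cong p≗q xs

  count-cong : ∀ {p q : A → Bool} → p ≗ q → count p ≗ count q
  count-cong p≗q xs = cong length (filterᵇ-cong p≗q xs)

  count-none : ∀ (xs : List A) → count (λ _ → false) xs ≡ 0
  count-none []       = refl
  count-none (_ ∷ xs) = count-none xs

  filterᵇ-∧ : ∀ (p q : A → Bool) xs → filterᵇ p (filterᵇ q xs) ≡ filterᵇ (λ x → p x ∧ q x) xs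
  filterᵇ-∧ p q [] = refl
  filterᵇ-∧ p q (x ∷ xs) with q x
  ... | false rewrite ∧-zeroʳ (p x) = filterᵇ-∧ p q xs
  ... | true  rewrite ∧-identityʳ (p x) with p x
  ...   | true  = cong (x ∷_) (filterᵇ-∧ p q xs)
  ...   | false = filterᵇ-∧ p q xs

  filterᵇ-comm : ∀ (p q : A → Bool) xs → filterᵇ p (filterᵇ q xs) ≡ filterᵇ q (filterᵇ p xs)
  filterᵇ-comm p q xs = trans (filterᵇ-∧ p q xs)
    (trans (filterᵇ-cong (λ x → ∧-comm (p x) (q x)) xs) (sym (filterᵇ-∧ q p xs)))

  filterᵇ-concatMap : ∀ (p : B → Bool) (f : A → List B) xs →
    filterᵇ p (concatMap f xs) ≡ concatMap (filterᵇ p ∘ f) xs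
  filterᵇ-concatMap p f [] = refl
  filterᵇ-concatMap p f (x ∷ xs) = trans (filter-++ _ (f x) (concatMap f xs))
    (cong (filterᵇ p (f x) ++_) (filterᵇ-concatMap p f xs))

  -- A condition on every member of a sublist can be imposed on the list beforehand. This turns the
  -- matchings through a head edge into matchings of a filtered list.
  count-sublists-all : ∀ (g : A → Bool) (Q : List A → Bool) E →
    count (λ m → allᵇ g m ∧ Q m) (sublists E) ≡ count Q (sublists (filterᵇ g E))
  count-sublists-all g Q [] with Q []
  ... | true  = refl
  ... | false = refl
  count-sublists-all g Q (e ∷ E) = trans (count-++ P (map (e ∷_) (sublists E)) (sublists E)) lem
    where
    P : List _ → Bool
    P m = allᵇ g m ∧ Q m
    lem : count P (map (e ∷_) (sublists E)) + count P (sublists E) ≡ count Q (sublists (filterᵇ g (e ∷ E)))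
    lem rewrite count-map P (e ∷_) (sublists E) with g e
    ... | false = cong₂ _+_ (count-none (sublists E)) (count-sublists-all g Q E)
    ... | true  = sym (trans (count-++ Q (map (e ∷_) S′) S′)
                    (cong₂ _+_
                      (trans (count-map Q (e ∷_) S′) (sym (count-sublists-all g (Q ∘ (e ∷_)) E)))
                      (sym (count-sublists-all g Q E))))
      where S′ = sublists (filterᵇ g E)

  -- For `E = edges G S` this unfolds to `numMatchings G S r`. Arbitrary edge lists are needed
  -- because the recursion on the head edge leaves the lists of the form `edges G S`.
  matchings : List (Edge n) → ℕ → ℕ
  matchings E r = count (λ m → isMatchingᵇ m ∧ (length m ≡ᵇ r)) (sublists E)

  _∖_ : List (Edge n) → Edge n → List (Edge n)
  E ∖ e = filterᵇ (disjointᵇ e) E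

  matchings-zero : ∀ (E : List (Edge n)) → matchings E 0 ≡ 1
  matchings-zero [] = refl
  matchings-zero (e ∷ E) = trans (count-++ P (map (e ∷_) (sublists E)) (sublists E))
    (cong₂ _+_
      (trans (count-map P (e ∷_) (sublists E))
        (trans (count-cong (λ m → ∧-zeroʳ (isMatchingᵇ (e ∷ m))) (sublists E)) (count-none (sublists E))))
      (matchings-zero E))
    where
    P : List _ → Bool
    P m = isMatchingᵇ m ∧ (length m ≡ᵇ 0)

  matchings-∷ : ∀ (e : Edge n) E r →
    matchings (e ∷ E) (suc r) ≡ matchings (E ∖ e) r + matchings E (suc r)
  matchings-∷ e E r = trans (count-++ P (map (e ∷_) (sublists E)) (sublists E))
    (cong (_+ matchings E (suc r))
      (trans (count-map P (e ∷_) (sublists E))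
        (trans (count-cong (λ m → ∧-assoc (allᵇ (disjointᵇ e) m) (isMatchingᵇ m) (length m ≡ᵇ r)) (sublists E))
          (count-sublists-all (disjointᵇ e) (λ m → isMatchingᵇ m ∧ (length m ≡ᵇ r)) E))))
    where
    P : List _ → Bool
    P m = isMatchingᵇ m ∧ (length m ≡ᵇ suc r)

  avoids : Fin n → Edge n → Bool
  avoids u (i , j) = not ((i == u) ∨ (j == u))

  _−_ : List (Edge n) → Fin n → List (Edge n)
  E − u = filterᵇ (avoids u) E

  lsum : (A → ℕ) → List A → ℕ
  lsum h []       = 0
  lsum h (x ∷ xs) = h x + lsum h xs

  lsum-++ : ∀ (h : A → ℕ) xs ys → lsum h (xs ++ ys) ≡ lsum h xs + lsum h ys
  lsum-++ h []       ys = refl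
  lsum-++ h (x ∷ xs) ys = trans (cong (h x +_) (lsum-++ h xs ys)) (sym (+-assoc (h x) _ _))

  lsum-cong : ∀ {g h : A → ℕ} → g ≗ h → lsum g ≗ lsum h
  lsum-cong g≗h []       = refl
  lsum-cong g≗h (x ∷ xs) = cong₂ _+_ (g≗h x) (lsum-cong g≗h xs)

  lsum-+ : ∀ (g h : A → ℕ) xs → lsum (λ x → g x + h x) xs ≡ lsum g xs + lsum h xs
  lsum-+ g h [] = refl
  lsum-+ g h (x ∷ xs) rewrite lsum-+ g h xs =
    solve 4 (λ a b c d → (a :+ b) :+ (c :+ d) := (a :+ c) :+ (b :+ d)) refl (g x) (h x) (lsum g xs) (lsum h xs)
    where open +-*-Solver

  lsum-filterᵇ : ∀ (p : A → Bool) (h : A → ℕ) xs →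
    lsum h (filterᵇ p xs) ≡ lsum (λ x → if p x then h x else 0) xs
  lsum-filterᵇ p h [] = refl
  lsum-filterᵇ p h (x ∷ xs) with p x
  ... | true  = cong (h x +_) (lsum-filterᵇ p h xs)
  ... | false = lsum-filterᵇ p h xs

  lsum-concatMap-tabulate : ∀ (h : B → ℕ) (f : A → List B) (g : Fin n → A) →
    lsum h (concatMap f (tabulate g)) ≡ sum (λ i → lsum h (f (g i)))
  lsum-concatMap-tabulate {n = zero}  h f g = refl
  lsum-concatMap-tabulate {n = suc n} h f g = trans (lsum-++ h (f (g zero)) _)
    (cong (lsum h (f (g zero)) +_) (lsum-concatMap-tabulate h f (g ∘ suc)))

  ==-refl : ∀ (i : Fin n) → (i == i) ≡ true
  ==-refl zero    = refl
  ==-refl (suc i) = ==-refl i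

  ==⇒≡ : ∀ (i j : Fin n) → (i == j) ≡ true → i ≡ j
  ==⇒≡ zero    zero    _  = refl
  ==⇒≡ (suc i) (suc j) eq = cong suc (==⇒≡ i j eq)

  ==-sym : ∀ (i j : Fin n) → (i == j) ≡ (j == i)
  ==-sym zero    zero    = refl
  ==-sym zero    (suc j) = refl
  ==-sym (suc i) zero    = refl
  ==-sym (suc i) (suc j) = ==-sym i j

  disjointᵇ-avoids : ∀ (i j : Fin n) e → disjointᵇ (i , j) e ≡ avoids i e ∧ avoids j e
  disjointᵇ-avoids i j (k , l) rewrite ==-sym k i | ==-sym l i | ==-sym k j | ==-sym l j
    with i == k | i == l | j == k | j == l
  ... | true  | _     | _     | _     = refl
  ... | false | true  | _     | _     = refl
  ... | false | false | true  | _     = refl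
  ... | false | false | false | true  = refl
  ... | false | false | false | false = refl

  disjointᵇ-sym : ∀ (e e′ : Edge n) → disjointᵇ e e′ ≡ disjointᵇ e′ e
  disjointᵇ-sym (i , j) (k , l) rewrite ==-sym k i | ==-sym l i | ==-sym k j | ==-sym l j
    with i == k | i == l | j == k | j == l
  ... | true  | _     | _     | _     = refl
  ... | false | true  | true  | _     = refl
  ... | false | true  | false | _     = refl
  ... | false | false | true  | _     = refl
  ... | false | false | false | true  = refl
  ... | false | false | false | false = refl

  touches⇒disjointᵇ-avoids : ∀ (u : Fin n) e → avoids u e ≡ false → ∀ e′ →
    disjointᵇ e e′ ∧ avoids u e′ ≡ disjointᵇ e e′
  touches⇒disjointᵇ-avoids u (i , j) t e′ rewrite disjointᵇ-avoids i j e′ with i == u in eq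
  ... | true rewrite ==⇒≡ i u eq with avoids u e′ | avoids j e′
  ...   | false | _     = refl
  ...   | true  | false = refl
  ...   | true  | true  = refl
  touches⇒disjointᵇ-avoids u (i , j) t e′ | false with j == u in eq
  ...   | true rewrite ==⇒≡ j u eq with avoids u e′ | avoids i e′
  ...     | false | false = refl
  ...     | false | true  = refl
  ...     | true  | false = refl
  ...     | true  | true  = refl
  touches⇒disjointᵇ-avoids u (i , j) () e′ | false | false

  ifTouches : Fin n → (Edge n → ℕ) → Edge n → ℕ
  ifTouches u F e = if avoids u e then 0 else F e

  ifTouches-cong : ∀ (u : Fin n) {F H : Edge n → ℕ} → F ≗ H → ifTouches u F ≗ ifTouches u H
  ifTouches-cong u F≗H e with avoids u e
  ... | true  = refl
  ... | false = F≗H e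

  -- A matching has at most one edge at `u`; if it has one, `e`, its other edges avoid `u` and are
  -- disjoint from `e`. The length bound `N` carries the induction, which is applied to the filtered
  -- list `E ∖ e` as well as to the tail.
  matchings-vertex′ : ∀ N (u : Fin n) E r → length E ≤ N →
    matchings E (suc r) ≡
    matchings (E − u) (suc r) + lsum (ifTouches u (λ e → matchings ((E − u) ∖ e) r)) E
  matchings-vertex′ N u [] r _ = refl
  matchings-vertex′ (suc N) u (e ∷ E) r (s≤s len) with avoids u e in eq
  -- The head touches `u`: an edge disjoint from it avoids `u`, so `E ∖ e` is already `(E − u) ∖ e`,
  -- and the new term is the head's own summand.
  ... | false = begin
    matchings (e ∷ E) (suc r)
      ≡⟨ matchings-∷ e E r ⟩
    matchings (E ∖ e) r + matchings E (suc r)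
      ≡⟨ cong₂ (λ L k → matchings L r + k) E∖e≡ (matchings-vertex′ N u E r len) ⟩
    matchings ((E − u) ∖ e) r + (matchings (E − u) (suc r) + t)
      ≡⟨ solve 3 (λ a b c → a :+ (b :+ c) := b :+ (a :+ c)) refl
           (matchings ((E − u) ∖ e) r) (matchings (E − u) (suc r)) t ⟩
    matchings (E − u) (suc r) + (matchings ((E − u) ∖ e) r + t) ∎
    where
    open ≡-Reasoning
    open +-*-Solver
    t = lsum (ifTouches u (λ e′ → matchings ((E − u) ∖ e′) r)) E
    E∖e≡ : E ∖ e ≡ (E − u) ∖ e
    E∖e≡ = sym (trans (filterᵇ-∧ (disjointᵇ e) (avoids u) E)
                      (filterᵇ-cong (touches⇒disjointᵇ-avoids u e eq) E))
  ... | true = begin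
    matchings (e ∷ E) (suc r)
      ≡⟨ matchings-∷ e E r ⟩
    matchings (E ∖ e) r + matchings E (suc r)
      ≡⟨ cong (matchings (E ∖ e) r +_) (matchings-vertex′ N u E r len) ⟩
    matchings (E ∖ e) r + (matchings (E − u) (suc r) + t r)
      ≡⟨ rest r ⟩
    (matchings ((E − u) ∖ e) r + matchings (E − u) (suc r)) + t′ r
      ≡⟨ cong (_+ t′ r) (sym (matchings-∷ e (E − u) r)) ⟩
    matchings (e ∷ (E − u)) (suc r) + t′ r ∎
    where
    open ≡-Reasoning
    open +-*-Solver
    t t′ : ℕ → ℕ
    t r = lsum (ifTouches u (λ e′ → matchings ((E − u) ∖ e′) r)) E
    t′ r = lsum (ifTouches u (λ e′ → matchings ((e ∷ (E − u)) ∖ e′) r)) E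

    rest : ∀ r → matchings (E ∖ e) r + (matchings (E − u) (suc r) + t r) ≡
           (matchings ((E − u) ∖ e) r + matchings (E − u) (suc r)) + t′ r
    -- For `r = 0` no further edge is chosen and every count of 0-matchings is 1.
    rest zero rewrite matchings-zero (E ∖ e) | matchings-zero ((E − u) ∖ e) =
      cong (λ z → suc (matchings (E − u) 1 + z))
        (lsum-cong (ifTouches-cong u (λ e′ → trans (matchings-zero ((E − u) ∖ e′))
                                                (sym (matchings-zero ((e ∷ (E − u)) ∖ e′))))) E)
    -- The matchings with the head `e`, which avoids `u`, are split again by their edge at `u`; in
    -- the summand of `e′` the head survives only if it is disjoint from `e′`.
    rest (suc r) = begin
      matchings (E ∖ e) (suc r) + (y + t (suc r))
        ≡⟨ cong (_+ (y + t (suc r))) (matchings-vertex′ N u (E ∖ e) r (≤-trans (length-filter _ E) len)) ⟩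
      (matchings ((E ∖ e) − u) (suc r) + lsum (ifTouches u K′) (E ∖ e)) + (y + t (suc r))
        ≡⟨ cong₂ (λ L k → (matchings L (suc r) + k) + (y + t (suc r)))
             (filterᵇ-comm (avoids u) (disjointᵇ e) E)
             (trans (lsum-filterᵇ (disjointᵇ e) (ifTouches u K′) E) (lsum-cong K′≗ E)) ⟩
      (x + lsum (ifTouches u K) E) + (y + t (suc r))
        ≡⟨ solve 4 (λ a b c d → (a :+ b) :+ (c :+ d) := (a :+ c) :+ (d :+ b)) refl
             x (lsum (ifTouches u K) E) y (t (suc r)) ⟩
      (x + y) + (t (suc r) + lsum (ifTouches u K) E)
        ≡⟨ cong ((x + y) +_) (sym (trans (lsum-cong t′≗ E) (lsum-+ _ _ E))) ⟩
      (x + y) + t′ (suc r) ∎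
      where
      x = matchings ((E − u) ∖ e) (suc r)
      y = matchings (E − u) (suc (suc r))
      K K′ : Edge _ → ℕ
      K′ e′ = matchings (((E ∖ e) − u) ∖ e′) r
      K e′ = if disjointᵇ e′ e then matchings (((E − u) ∖ e′) ∖ e) r else 0
      K′≗ : ∀ e′ → (if disjointᵇ e e′ then ifTouches u K′ e′ else 0) ≡ ifTouches u K e′
      K′≗ e′ rewrite disjointᵇ-sym e e′ with avoids u e′ | disjointᵇ e′ e
      ... | true  | true  = refl
      ... | true  | false = refl
      ... | false | false = refl
      ... | false | true  = cong (λ L → matchings L r)
        (trans (cong (_∖ e′) (filterᵇ-comm (avoids u) (disjointᵇ e) E))
               (filterᵇ-comm (disjointᵇ e′) (disjointᵇ e) (E − u)))
      t′≗ : ∀ e′ → ifTouches u (λ e′ → matchings ((e ∷ (E − u)) ∖ e′) (suc r)) e′ ≡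
            ifTouches u (λ e′ → matchings ((E − u) ∖ e′) (suc r)) e′ + ifTouches u K e′
      t′≗ e′ with avoids u e′
      ... | true = refl
      ... | false with disjointᵇ e′ e
      ...   | false = sym (+-identityʳ _)
      ...   | true  = trans (matchings-∷ e ((E − u) ∖ e′) r) (+-comm _ (matchings ((E − u) ∖ e′) (suc r)))

  matchings-vertex : ∀ (u : Fin n) E r →
    matchings E (suc r) ≡
    matchings (E − u) (suc r) + lsum (ifTouches u (λ e → matchings ((E − u) ∖ e) r)) E
  matchings-vertex u E r = matchings-vertex′ (length E) u E r ≤-refl

  -- Edge lists of induced subgraphs

  edges-delete : ∀ (G : Graph n) S u → edges G S − u ≡ edges G (S ⊝ u)
  edges-delete {n} G S u =
    trans (filterᵇ-concatMap (avoids u) _ (allFin n)) (concatMap-cong (λ i →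
    trans (filterᵇ-concatMap (avoids u) _ (allFin n)) (concatMap-cong (λ j →
    cell i j) (allFin n))) (allFin n))
    where
    cell : ∀ i j →
      filterᵇ (avoids u) (if (toℕ i <ᵇ toℕ j) ∧ lookup S i ∧ lookup S j ∧ adj G i j then [ (i , j) ] else [])
      ≡ (if (toℕ i <ᵇ toℕ j) ∧ lookup (S ⊝ u) i ∧ lookup (S ⊝ u) j ∧ adj G i j then [ (i , j) ] else [])
    cell i j rewrite lookup-delete S u i | lookup-delete S u j
      with toℕ i <ᵇ toℕ j | lookup S i | lookup S j | adj G i j
    ... | false | _     | _     | _     = refl
    ... | true  | false | _     | _     = refl
    ... | true  | true  | false | _     with i == u
    ...   | true = refl
    ...   | false = refl
    cell i j | true  | true  | true  | false with i == u | j == u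
    ...   | true  | _ = refl
    ...   | false | true = refl
    ...   | false | false = refl
    cell i j | true  | true  | true  | true with i == u | j == u
    ...   | true  | _     = refl
    ...   | false | true  = refl
    ...   | false | false = refl

  edges-∖ : ∀ (G : Graph n) S i j → edges G S ∖ (i , j) ≡ edges G (S ⊝ j ⊝ i)
  edges-∖ G S i j = begin
    edges G S ∖ (i , j)
      ≡⟨ filterᵇ-cong (disjointᵇ-avoids i j) (edges G S) ⟩
    filterᵇ (λ e → avoids i e ∧ avoids j e) (edges G S)
      ≡⟨ sym (filterᵇ-∧ (avoids i) (avoids j) (edges G S)) ⟩
    (edges G S − j) − i
      ≡⟨ cong (_− i) (edges-delete G S j) ⟩
    edges G (S ⊝ j) − i
      ≡⟨ edges-delete G (S ⊝ j) i ⟩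
    edges G (S ⊝ j ⊝ i) ∎
    where open ≡-Reasoning

  sum-delta : ∀ (u : Fin n) (h : Fin n → ℕ) → sum (λ i → if i == u then h i else 0) ≡ h u
  sum-delta {suc n} zero    h = trans (cong (h zero +_) (sum-replicate-zero n)) (+-identityʳ _)
  sum-delta {suc n} (suc u) h = sum-delta u (h ∘ suc)

  <ᵇ-trichotomy : ∀ {m n} → m ≢ n → (m <ᵇ n) ≡ Bool.not (n <ᵇ m)
  <ᵇ-trichotomy {zero}  {zero}  ne = contradiction refl ne
  <ᵇ-trichotomy {zero}  {suc n} ne = refl
  <ᵇ-trichotomy {suc m} {zero}  ne = refl
  <ᵇ-trichotomy {suc m} {suc n} ne = <ᵇ-trichotomy (ne ∘ cong suc)

  <ᵇ-irrefl : ∀ m → (m <ᵇ m) ≡ false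
  <ᵇ-irrefl zero    = refl
  <ᵇ-irrefl (suc m) = <ᵇ-irrefl m

  module _ (G : Graph n) (S : Subset n) (u : Fin n) (Su : lookup S u ≡ true) where

    private
      S−u : Subset n
      S−u = S ⊝ u

    -- An edge at u is listed as (u , v) if u < v (counted by α) and as (v , u) if v < u (counted by β).
    lsum-edges : ∀ (F : Edge n → ℕ) (g : Fin n → ℕ) → (∀ v → v ≢ u → F (u , v) ≡ g v) → (∀ v → v ≢ u → F (v , u) ≡ g v) →
      lsum (ifTouches u F) (edges G S) ≡ sum (λ v → if adj G u v ∧ lookup S−u v then g v else 0)
    lsum-edges F g Fuv Fvu = begin
      lsum (ifTouches u F) (edges G S)
        ≡⟨ lsum-concatMap-tabulate (ifTouches u F) (λ i → concatMap (cell i) (allFin n)) id ⟩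
      sum (λ i → lsum (ifTouches u F) (concatMap (cell i) (allFin n)))
        ≡⟨ sum-cong-≗ (λ i → lsum-concatMap-tabulate (ifTouches u F) (cell i) id) ⟩
      sum (λ i → sum (λ j → lsum (ifTouches u F) (cell i j)))
        ≡⟨ sum-cong-≗ (λ i → sum-cong-≗ (λ j → split i j)) ⟩
      sum (λ i → sum (λ j → (if i == u then α j else 0) + (if j == u then β i else 0)))
        ≡⟨ sum-cong-≗ (λ i → ∑-distrib-+ (λ j → if i == u then α j else 0) (λ j → if j == u then β i else 0)) ⟩
      sum (λ i → sum (λ j → if i == u then α j else 0) + sum (λ j → if j == u then β i else 0))
        ≡⟨ ∑-distrib-+ (λ i → sum (λ j → if i == u then α j else 0)) (λ i → sum (λ j → if j == u then β i else 0)) ⟩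
      sum (λ i → sum (λ j → if i == u then α j else 0)) + sum (λ i → sum (λ j → if j == u then β i else 0))
        ≡⟨ cong₂ _+_ (trans (∑-comm (λ i j → if i == u then α j else 0)) (sum-cong-≗ (λ j → sum-delta u (λ _ → α j))))
                     (sum-cong-≗ (λ i → sum-delta u (λ _ → β i))) ⟩
      sum α + sum β
        ≡⟨ sym (∑-distrib-+ α β) ⟩
      sum (λ v → α v + β v)
        ≡⟨ sum-cong-≗ merge ⟩
      sum (λ v → if adj G u v ∧ lookup S−u v then g v else 0) ∎
      where
      open ≡-Reasoning
      isEdge : Fin n → Fin n → Bool
      isEdge i j = (toℕ i <ᵇ toℕ j) ∧ lookup S i ∧ lookup S j ∧ adj G i j
      cell : Fin n → Fin n → List (Edge n)
      cell i j = if isEdge i j then [ (i , j) ] else []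
      α β : Fin n → ℕ
      α j = if isEdge u j then g j else 0
      β i = if isEdge i u then g i else 0

      isEdge-irrefl : isEdge u u ≡ false
      isEdge-irrefl rewrite <ᵇ-irrefl (toℕ u) = refl

      split : ∀ i j → lsum (ifTouches u F) (cell i j) ≡ (if i == u then α j else 0) + (if j == u then β i else 0)
      split i j with i == u in iu
      split i j | true rewrite ==⇒≡ i u iu with j == u in ju
      ... | true  rewrite ==⇒≡ j u ju | isEdge-irrefl = refl
      ... | false with isEdge u j
      ...   | false = refl
      ...   | true rewrite ==-refl u = cong (_+ 0) (Fuv j λ { refl → contradiction (trans (sym ju) (==-refl u)) λ () })
      split i j | false with j == u in ju
      ... | true  rewrite ==⇒≡ j u ju with isEdge i u
      ...   | false = refl
      ...   | true rewrite iu | ==-refl u = trans (+-identityʳ _) (Fvu i λ { refl → contradiction (trans (sym iu) (==-refl u)) λ () })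
      split i j | false | false with isEdge i j
      ...   | false = refl
      ...   | true rewrite iu | ju = refl

      -- For `v ≠ u` exactly one orientation of the edge is listed, so the two indicators add up to
      -- one; `v = u` contributes nothing on either side.
      merge : ∀ v → α v + β v ≡ (if adj G u v ∧ lookup S−u v then g v else 0)
      merge v rewrite lookup-delete S u v with v == u in vu
      ... | true  rewrite ==⇒≡ v u vu | isEdge-irrefl | ∧-zeroʳ (lookup S u) | ∧-zeroʳ (adj G u u) = refl
      ... | false rewrite Su | adj-sym G v u | ∧-identityʳ (lookup S v)
          | <ᵇ-trichotomy {toℕ u} {toℕ v} (λ eq → contradiction (trans (sym vu) (trans (cong (_== u) (sym (Fin.toℕ-injective eq))) (==-refl u))) λ ())
          with toℕ v <ᵇ toℕ u | lookup S v | adj G u v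
      ...   | true  | false | false = refl
      ...   | true  | false | true  = refl
      ...   | true  | true  | false = refl
      ...   | true  | true  | true  = refl
      ...   | false | false | false = refl
      ...   | false | false | true  = refl
      ...   | false | true  | false = refl
      ...   | false | true  | true  = +-identityʳ _

    numMatchings-vertex : ∀ r → numMatchings G S (suc r) ≡ numMatchings G S−u (suc r) +
      sum (λ v → if adj G u v ∧ lookup S−u v then numMatchings G (S−u ⊝ v) r else 0)
    numMatchings-vertex r = trans (matchings-vertex u (edges G S) r)
      (cong₂ _+_ (cong (λ L → matchings L (suc r)) (edges-delete G S u))
        (lsum-edges _ (λ v → numMatchings G (S−u ⊝ v) r)
          -- Deleting both ends of the edge from `S−u` deletes `u` a second time; commutation and
          -- idempotence bring both orientations to `S−u ⊝ v`.
          (λ v v≢u → cong (λ L → matchings L r) (trans (cong (_∖ (u , v)) (edges-delete G S u)) (trans (edges-∖ G S−u u v)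
             (cong (edges G) (trans ([]≔-commutes S−u v u v≢u) (cong (_⊝ v) ([]≔-idempotent S u)))))))
          (λ v v≢u → cong (λ L → matchings L r) (trans (cong (_∖ (v , u)) (edges-delete G S u)) (trans (edges-∖ G S−u v u)
             (cong (λ T → edges G (T ⊝ v)) ([]≔-idempotent S u)))))))

  concatMap-[] : ∀ (f : A → List B) xs → (∀ x → f x ≡ []) → concatMap f xs ≡ []
  concatMap-[] f []       f≡[] = refl
  concatMap-[] f (x ∷ xs) f≡[] rewrite f≡[] x = concatMap-[] f xs f≡[]

  edges-empty : ∀ (G : Graph n) S → (∀ i → lookup S i ≡ false) → edges G S ≡ []
  edges-empty {n} G S none = concatMap-[] _ (allFin n) λ i → concatMap-[] _ (allFin n) λ j → cell i j
    where
    cell : ∀ i j → (if (toℕ i <ᵇ toℕ j) ∧ lookup S i ∧ lookup S j ∧ adj G i j then [ (i , j) ] else []) ≡ []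
    cell i j rewrite none i | ∧-zeroʳ (toℕ i <ᵇ toℕ j) = refl

  -- Induction on the size through the vertex recurrence: the first term loses one vertex, the
  -- neighbour terms two vertices and one edge. This makes the truncated subtraction in the
  -- exponents of `μ` harmless: wherever it truncates, the coefficient is 0.
  numMatchings-vanish : ∀ (G : Graph n) k S r → ∣ S ∣ ≡ k → k < 2 * r → numMatchings G S r ≡ 0
  numMatchings-vanish {n} G k S (suc r) size lt with empty-or-member S
  ... | inj₁ none = cong (λ E → matchings E (suc r)) (edges-empty G S none)
  ... | inj₂ (u , Su) with k | trans (sym size) (∣delete∣ S u Su)
  ...   | suc k′ | size′ = trans (numMatchings-vertex G S u Su r)
    (cong₂ _+_ (numMatchings-vanish G k′ T (suc r) (sym (suc-injective size′)) (<-trans (n<1+n k′) lt))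
      (trans (sum-cong-≗ (λ v → deleted k′ (sym (suc-injective size′)) lt v)) (sum-replicate-zero n)))
    where
    T = S ⊝ u
    deleted : ∀ k′ → ∣ T ∣ ≡ k′ → suc k′ < 2 * suc r → ∀ v →
      (if adj G u v ∧ lookup T v then numMatchings G (T ⊝ v) r else 0) ≡ 0
    deleted k′ eq lt v with adj G u v | lookup T v in Tv
    ... | false | _     = refl
    ... | true  | false = refl
    ... | true  | true  with k′ | trans (sym eq) (∣delete∣ T v Tv)
    ...   | suc k″ | eq′ = numMatchings-vanish G k″ (T ⊝ v) r (sym (suc-injective eq′))
      (≤-pred (≤-pred (subst (suc (suc (suc k″)) ≤_) (cong suc (+-suc r (r + 0))) lt)))

open Matchings using (matchings-zero; numMatchings-vertex; numMatchings-vanish)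

-- The Heilmann–Lieb identity

module SumsOfSquares {c ℓ} (R : CommutativeRing c ℓ) where
  open CommutativeRing R hiding (zero)
  open Algebra.Properties.CommutativeMonoid.Sum +-commutativeMonoid using (sum; sum-cong-≋; ∑-distrib-+; sum-replicate-zero)
  open Relation.Binary.Reasoning.Setoid setoid
  open Algebra.Solver.Ring.NaturalCoefficients.Default commutativeSemiring

  data SumOfSquares : Carrier → Set (c ⊔ ℓ) where
    sos-zero   : SumOfSquares 0#
    sos-square : ∀ q {r} → SumOfSquares r → SumOfSquares (q * q + r)
    sos-resp   : ∀ {p q} → p ≈ q → SumOfSquares p → SumOfSquares q

  SumOfSquares-+ : ∀ {p q} → SumOfSquares p → SumOfSquares q → SumOfSquares (p + q)
  SumOfSquares-+ sos-zero         T = sos-resp (sym (+-identityˡ _)) T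
  SumOfSquares-+ (sos-square q S) T = sos-resp (sym (+-assoc _ _ _)) (sos-square q (SumOfSquares-+ S T))
  SumOfSquares-+ (sos-resp e S)   T = sos-resp (+-congʳ e) (SumOfSquares-+ S T)

  -- The difference b - a is a sum of squares, phrased without subtraction like the recurrence.
  SumOfSquares-excess : Carrier → Carrier → Set (c ⊔ ℓ)
  SumOfSquares-excess a b = ∃ λ t → SumOfSquares t × t + a ≈ b

  excess-sum : ∀ a b (c d : Fin n → Carrier) → (∀ w → SumOfSquares-excess (a * c w) (d w * b)) →
    SumOfSquares-excess (a * sum c) (sum d * b)
  excess-sum {n = zero}  a b c d h = 0# , sos-zero , trans (+-identityˡ _) (trans (zeroʳ a) (sym (zeroˡ b)))
  excess-sum {n = suc n} a b c d h with h zero | excess-sum a b (c ∘ suc) (d ∘ suc) (h ∘ suc)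
  ... | t , T , e | t′ , T′ , e′ = t + t′ , SumOfSquares-+ T T′ , (begin
    t + t′ + a * (c₀ + c⁺)          ≈⟨ solve 5 (λ t t′ a c c′ → t :+ t′ :+ a :* (c :+ c′) := (t :+ a :* c) :+ (t′ :+ a :* c′)) refl t t′ a c₀ c⁺ ⟩
    (t + a * c₀) + (t′ + a * c⁺)    ≈⟨ +-cong e e′ ⟩
    d₀ * b + d⁺ * b                 ≈⟨ distribʳ b d₀ d⁺ ⟨
    (d₀ + d⁺) * b                   ∎)
    where
    c₀ = c zero
    c⁺ = sum (c ∘ suc)
    d₀ = d zero
    d⁺ = sum (d ∘ suc)

  neighbourSum : (Fin n → Fin n → Bool) → (Subset n → Carrier) → Subset n → Fin n → Carrier
  neighbourSum A M S u = sum (λ v → if A u v ∧ lookup (S ⊝ u) v then M (S ⊝ u ⊝ v) else 0#)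

  -- M S = x u M (S ⊝ u) − Σ M (S ⊝ u ⊝ v), rearranged so that no subtraction occurs.
  Recurrence : (Fin n → Fin n → Bool) → (Fin n → Carrier) → (Subset n → Carrier) → Set ℓ
  Recurrence A x M = ∀ S u → lookup S u ≡ true → M S + neighbourSum A M S u ≈ x u * M (S ⊝ u)

  -- M for the weights in which x w is raised by 1: M is affine in x w with slope M (S ⊝ w).
  perturb : (Subset n → Carrier) → Fin n → Subset n → Carrier
  perturb M w S = M S + (if lookup S w then M (S ⊝ w) else 0#)

  perturbedWeight : (Fin n → Carrier) → Fin n → Fin n → Carrier
  perturbedWeight x w u = if does (u Fin.≟ w) then x u + 1# else x u

  module _ (A : Fin n → Fin n → Bool) (x : Fin n → Carrier) (M : Subset n → Carrier) (rec : Recurrence A x M) where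

    -- Heilmann–Lieb: the excess is the sum of M (S ∖ P)² over all paths P from u to v;
    -- expanding M S and M (S ⊝ v) at u amounts to choosing the second vertex w of the path.
    rayleigh : ∀ k S u v → ∣ S ∣ ≡ k → lookup S u ≡ true → lookup S v ≡ true → u ≢ v →
      SumOfSquares-excess (M S * M (S ⊝ u ⊝ v)) (M (S ⊝ u) * M (S ⊝ v))
    rayleigh zero S u v size Su Sv u≢v = contradiction (≡.trans (≡.sym size) (∣delete∣ S u Su)) λ ()
    -- Multiply the recurrence for `S ⊝ v` by `a` and the one for `S` by `b`: the terms with `x u`
    -- agree, and subtracting leaves a q - p b = (Σ h) b - a (Σ g), which is treated neighbour by
    -- neighbour.
    rayleigh (suc k) S u v size Su Sv u≢v = t , proj₁ (proj₂ total) , +-cancelʳ (a * sum g) _ _ (begin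
      (t + p * b) + a * sum g   ≈⟨ solve 3 (λ t pb ac → (t :+ pb) :+ ac := (t :+ ac) :+ pb) refl t (p * b) (a * sum g) ⟩
      (t + a * sum g) + p * b   ≈⟨ +-congʳ (proj₂ (proj₂ total)) ⟩
      sum h * b + p * b         ≈⟨ solve 3 (λ d b p → d :* b :+ p :* b := (p :+ d) :* b) refl (sum h) b p ⟩
      (p + sum h) * b           ≈⟨ *-congʳ (rec S u Su) ⟩
      (x u * a) * b             ≈⟨ solve 3 (λ x a b → (x :* a) :* b := a :* (x :* b)) refl (x u) a b ⟩
      a * (x u * b)             ≈⟨ *-congˡ rec-v ⟨
      a * (q + sum g)           ≈⟨ distribˡ a q (sum g) ⟩
      a * q + a * sum g         ∎)
      where
      open Algebra.Properties.Ring ring using (+-cancelʳ)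
      T = S ⊝ u
      p = M S
      q = M (S ⊝ v)
      a = M T
      b = M (T ⊝ v)
      g h : Fin _ → Carrier
      g w = if A u w ∧ lookup (T ⊝ v) w then M (T ⊝ v ⊝ w) else 0#
      h w = if A u w ∧ lookup T w then M (T ⊝ w) else 0#

      nothing : SumOfSquares-excess (a * 0#) (0# * b)
      nothing = 0# , sos-zero , trans (+-identityˡ _) (trans (zeroʳ a) (sym (zeroˡ b)))

      step : ∀ w → SumOfSquares-excess (a * g w) (h w * b)
      step w with A u w
      ... | false = nothing
      ... | true with w Fin.≟ v
      -- The path is the edge from `u` to `v`: the term of `g` is 0 because `v` is already deleted,
      -- and what remains is the square of `b`.
      ...   | yes ≡.refl rewrite ⊝-removed T v | ⊝-kept S (u≢v ∘ ≡.sym) | Sv =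
        b * b + 0# , sos-square b sos-zero , trans (+-congˡ (zeroʳ a)) (trans (+-identityʳ _) (+-identityʳ _))
      ...   | no w≢v rewrite ⊝-kept T w≢v with lookup T w in Tw
      ...     | false = nothing
      -- The path goes on from `w`: this is the same statement for the pair `w`, `v` in `S ⊝ u`.
      ...     | true rewrite ⊝-comm T (w≢v ∘ ≡.sym) =
        rayleigh k T w v (≡.sym (ℕ.suc-injective (≡.trans (≡.sym size) (∣delete∣ S u Su)))) Tw
          (≡.trans (⊝-kept S (u≢v ∘ ≡.sym)) Sv) w≢v

      total = excess-sum a b g h step
      t = proj₁ total

      rec-v : q + sum g ≈ x u * b
      rec-v with rec (S ⊝ v) u (≡.trans (⊝-kept S u≢v) Su)
      ... | r rewrite ⊝-comm S (u≢v ∘ ≡.sym) = r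

    -- At `u = w` the neighbour terms lack `w` and do not change, while the extra `M (S ⊝ u)` is
    -- what the raised weight contributes. At `u ≠ w` the added part `N` satisfies the recurrence
    -- with the old weight, because deleting `w` commutes with the other deletions.
    perturb-recurrence : ∀ w → Recurrence A (perturbedWeight x w) (perturb M w)
    perturb-recurrence w S u Su with u Fin.≟ w
    ... | yes ≡.refl rewrite Su | ⊝-removed S u = begin
      (M S + M (S ⊝ u)) + neighbourSum A (perturb M u) S u   ≈⟨ +-congˡ (sum-cong-≋ unchanged) ⟩
      (M S + M (S ⊝ u)) + neighbourSum A M S u
        ≈⟨ solve 3 (λ p q s → (p :+ q) :+ s := (p :+ s) :+ q) refl (M S) (M (S ⊝ u)) (neighbourSum A M S u) ⟩
      (M S + neighbourSum A M S u) + M (S ⊝ u)             ≈⟨ +-congʳ (rec S u Su) ⟩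
      x u * M (S ⊝ u) + M (S ⊝ u)
        ≈⟨ +-congˡ (*-identityˡ _) ⟨
      x u * M (S ⊝ u) + 1# * M (S ⊝ u)                     ≈⟨ distribʳ _ (x u) 1# ⟨
      (x u + 1#) * M (S ⊝ u)                               ≈⟨ *-congˡ (+-identityʳ _) ⟨
      (x u + 1#) * (M (S ⊝ u) + 0#)                        ∎
      where
      unchanged : ∀ v → (if A u v ∧ lookup (S ⊝ u) v then perturb M u (S ⊝ u ⊝ v) else 0#) ≈
                        (if A u v ∧ lookup (S ⊝ u) v then M (S ⊝ u ⊝ v) else 0#)
      unchanged v with A u v ∧ lookup (S ⊝ u) v
      ... | false = refl
      ... | true rewrite ⊝-absent (S ⊝ u) v (⊝-removed S u) = +-identityʳ _
    ... | no u≢w = begin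
      (M S + N S) + neighbourSum A (perturb M w) S u       ≈⟨ +-congˡ (trans (sum-cong-≋ split) (∑-distrib-+ (term M) (term N))) ⟩
      (M S + N S) + (neighbourSum A M S u + neighbourSum A N S u)
        ≈⟨ solve 4 (λ a b c d → (a :+ b) :+ (c :+ d) := (a :+ c) :+ (b :+ d)) refl (M S) (N S) (neighbourSum A M S u) (neighbourSum A N S u) ⟩
      (M S + neighbourSum A M S u) + (N S + neighbourSum A N S u)   ≈⟨ +-cong (rec S u Su) N-rec ⟩
      x u * M (S ⊝ u) + x u * N (S ⊝ u)                  ≈⟨ distribˡ (x u) _ _ ⟨
      x u * perturb M w (S ⊝ u)                            ∎
      where
      N : Subset n → Carrier
      N S = if lookup S w then M (S ⊝ w) else 0#

      term : (Subset n → Carrier) → Fin n → Carrier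
      term M v = if A u v ∧ lookup (S ⊝ u) v then M (S ⊝ u ⊝ v) else 0#

      split : ∀ v → term (perturb M w) v ≈ term M v + term N v
      split v with A u v ∧ lookup (S ⊝ u) v
      ... | false = sym (+-identityˡ 0#)
      ... | true  = refl

      zeroTerm : ∀ b v → lookup (S ⊝ u ⊝ v) w ≡ false → (if b then N (S ⊝ u ⊝ v) else 0#) ≈ 0#
      zeroTerm false v _ = refl
      zeroTerm true  v e rewrite e = refl

      N-rec : N S + neighbourSum A N S u ≈ x u * N (S ⊝ u)
      N-rec rewrite ⊝-kept S (u≢w ∘ ≡.sym) with lookup S w in Sw
      ... | false = begin
        0# + neighbourSum A N S u     ≈⟨ +-identityˡ _ ⟩
        neighbourSum A N S u          ≈⟨ sum-cong-≋ (λ v → zeroTerm (A u v ∧ lookup (S ⊝ u) v) v (⊝-absent (S ⊝ u) v (⊝-absent S u Sw))) ⟩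
        sum {n} (λ _ → 0#)            ≈⟨ sum-replicate-zero n ⟩
        0#                            ≈⟨ zeroʳ (x u) ⟨
        x u * 0#                      ∎
      ... | true = begin
        M (S ⊝ w) + neighbourSum A N S u             ≈⟨ +-congˡ (sum-cong-≋ agree) ⟩
        M (S ⊝ w) + neighbourSum A M (S ⊝ w) u       ≈⟨ rec (S ⊝ w) u (≡.trans (⊝-kept S u≢w) Su) ⟩
        x u * M (S ⊝ w ⊝ u)                          ≡⟨ ≡.cong (λ T → x u * M T) (⊝-comm S (u≢w ∘ ≡.sym)) ⟩
        x u * M (S ⊝ u ⊝ w)                          ∎
        where
        agree : ∀ v → (if A u v ∧ lookup (S ⊝ u) v then N (S ⊝ u ⊝ v) else 0#) ≈
                      (if A u v ∧ lookup (S ⊝ w ⊝ u) v then M (S ⊝ w ⊝ u ⊝ v) else 0#)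
        agree v with v Fin.≟ w
        -- The neighbour equal to `w` drops out on both sides: on the left `N` vanishes once it is
        -- deleted, on the right it is no longer a vertex.
        ... | yes ≡.refl rewrite ⊝-absent (S ⊝ v) u (⊝-removed S v) | ∧-zeroʳ (A u v) =
          zeroTerm (A u v ∧ lookup (S ⊝ u) v) v (⊝-removed (S ⊝ u) v)
        ... | no v≢w rewrite ⊝-comm S (u≢w ∘ ≡.sym) | ⊝-kept (S ⊝ u) v≢w with A u v ∧ lookup (S ⊝ u) v
        ...   | false = refl
        ...   | true rewrite ⊝-kept (S ⊝ u) (v≢w ∘ ≡.sym) | ⊝-kept S (u≢w ∘ ≡.sym) | Sw | ⊝-comm (S ⊝ u) v≢w = refl

module RealPolynomials {c ℓ} (ℝ : RealNumbers c ℓ) where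

  open RealNumbers ℝ renaming (_<_ to infix 4 _<_; _≤ℝ_ to infix 4 _≤ℝ_) hiding (zero)
  open Algebra.Properties.Ring ring using (-0#≈0#; -‿distribˡ-*; -‿distribʳ-*; -‿involutive; -‿+-comm)
  open IsStrictTotalOrder isStrictTotalOrder using (compare; <-resp-≈) renaming (trans to <-trans; irrefl to <-irrefl)
  private
    module ℝ-Solver = Algebra.Solver.Ring.NaturalCoefficients.Default commutativeSemiring
    module ℝ-Reasoning = Relation.Binary.Reasoning.Setoid setoid

  -- Arithmetic of the ordered field

  <-respʳ : ∀ {x y z} → y ≈ z → x < y → x < z
  <-respʳ = proj₁ <-resp-≈

  <-respˡ : ∀ {x y z} → y ≈ z → y < x → z < x
  <-respˡ = proj₂ <-resp-≈

  0<⇒≉0 : ∀ {a} → 0# < a → ¬ (a ≈ 0#)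
  0<⇒≉0 0<a a≈0 = <-irrefl (sym a≈0) 0<a

  +-pos : ∀ {a b} → 0# < a → 0# < b → 0# < a + b
  +-pos {a} {b} 0<a 0<b = <-trans 0<b (<-respˡ (+-identityˡ b) (+-mono-< b 0<a))

  neg-pos : ∀ {a} → a < 0# → 0# < - a
  neg-pos {a} a<0 = <-respʳ (+-identityˡ _) (<-respˡ (-‿inverseʳ a) (+-mono-< (- a) a<0))

  -a*-b≈a*b : ∀ a b → - a * - b ≈ a * b
  -a*-b≈a*b a b = trans (sym (-‿distribˡ-* a (- b)))
    (trans (-‿cong (sym (-‿distribʳ-* a b))) (-‿involutive (a * b)))

  square-pos : ∀ {a} → ¬ (a ≈ 0#) → 0# < a * a
  square-pos {a} a≉0 with compare a 0#
  ... | tri< a<0 _ _ = <-respʳ (-a*-b≈a*b a a) (*-pos (neg-pos a<0) (neg-pos a<0))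
  ... | tri≈ _ a≈0 _ = contradiction a≈0 a≉0
  ... | tri> _ _ 0<a = *-pos 0<a 0<a

  *-≉0 : ∀ {a b} → ¬ (a ≈ 0#) → ¬ (b ≈ 0#) → ¬ (a * b ≈ 0#)
  *-≉0 {a} {b} a≉0 b≉0 ab≈0 with inverse a a≉0
  ... | a⁻¹ , aa⁻¹≈1 = b≉0 (begin
    b               ≈⟨ *-identityˡ b ⟨
    1# * b          ≈⟨ *-congʳ aa⁻¹≈1 ⟨
    (a * a⁻¹) * b   ≈⟨ solve 3 (λ a i b → (a :* i) :* b := i :* (a :* b)) refl a a⁻¹ b ⟩
    a⁻¹ * (a * b)   ≈⟨ *-congˡ ab≈0 ⟩
    a⁻¹ * 0#        ≈⟨ zeroʳ a⁻¹ ⟩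
    0#              ∎)
    where open ℝ-Reasoning
          open ℝ-Solver

  0<*⇒≉0ʳ : ∀ {a b} → 0# < a * b → ¬ (b ≈ 0#)
  0<*⇒≉0ʳ {a} 0<ab b≈0 = 0<⇒≉0 0<ab (trans (*-congˡ b≈0) (zeroʳ a))

  *-interchange : ∀ a b c d → (a * b) * (c * d) ≈ (a * c) * (b * d)
  *-interchange = solve 4 (λ a b c d → (a :* b) :* (c :* d) := (a :* c) :* (b :* d)) refl
    where open ℝ-Solver

  -‿≉0 : ∀ {a} → ¬ (a ≈ 0#) → ¬ (- a ≈ 0#)
  -‿≉0 {a} a≉0 -a≈0 = a≉0 (trans (sym (-‿involutive a)) (trans (-‿cong -a≈0) -0#≈0#))

  -- The ring of coefficient lists

  infixl 6 _⊕_
  infixl 7 _⊛_ _·_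
  infix  4 _≋_

  _⊕_ _⊛_ : Poly ℝ → Poly ℝ → Poly ℝ
  _⊕_ = _+ₚ_ ℝ
  _⊛_ = _*ₚ_ ℝ

  _≋_ : Poly ℝ → Poly ℝ → Set (c ⊔ ℓ)
  _≋_ = _≈ₚ_ ℝ

  _·_ : Carrier → Poly ℝ → Poly ℝ
  a · p = map (a *_) p

  ⊖_ : Poly ℝ → Poly ℝ
  ⊖ p = map -_ p

  ≋-refl : ∀ {p} → p ≋ p
  ≋-refl {[]}    = []≈[]
  ≋-refl {_ ∷ _} = ∷≈∷ refl ≋-refl

  ≋-sym : ∀ {p q} → p ≋ q → q ≋ p
  ≋-sym []≈[]        = []≈[]
  ≋-sym ([]≈∷ b≈0 e) = ∷≈[] b≈0 (≋-sym e)
  ≋-sym (∷≈[] a≈0 e) = []≈∷ a≈0 (≋-sym e)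
  ≋-sym (∷≈∷ a≈b e)  = ∷≈∷ (sym a≈b) (≋-sym e)

  ≋-trans : ∀ {p q r} → p ≋ q → q ≋ r → p ≋ r
  ≋-trans []≈[]        f            = f
  ≋-trans ([]≈∷ b≈0 e) (∷≈[] _ f)   = []≈[]
  ≋-trans ([]≈∷ b≈0 e) (∷≈∷ b≈c f)  = []≈∷ (trans (sym b≈c) b≈0) (≋-trans e f)
  ≋-trans (∷≈[] a≈0 e) []≈[]        = ∷≈[] a≈0 e
  ≋-trans (∷≈[] a≈0 e) ([]≈∷ c≈0 f) = ∷≈∷ (trans a≈0 (sym c≈0)) (≋-trans e f)
  ≋-trans (∷≈∷ a≈b e)  (∷≈[] b≈0 f) = ∷≈[] (trans a≈b b≈0) (≋-trans e f)
  ≋-trans (∷≈∷ a≈b e)  (∷≈∷ b≈c f)  = ∷≈∷ (trans a≈b b≈c) (≋-trans e f)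

  ⊕-identityʳ : ∀ p → p ⊕ [] ≋ p
  ⊕-identityʳ []      = []≈[]
  ⊕-identityʳ (_ ∷ _) = ≋-refl

  ⊕-comm : ∀ p q → p ⊕ q ≋ q ⊕ p
  ⊕-comm []      q       = ≋-sym (⊕-identityʳ q)
  ⊕-comm (a ∷ p) []      = ≋-refl
  ⊕-comm (a ∷ p) (b ∷ q) = ∷≈∷ (+-comm a b) (⊕-comm p q)

  ⊕-assoc : ∀ p q r → (p ⊕ q) ⊕ r ≋ p ⊕ (q ⊕ r)
  ⊕-assoc []      q       r       = ≋-refl
  ⊕-assoc (a ∷ p) []      r       = ≋-refl
  ⊕-assoc (a ∷ p) (b ∷ q) []      = ≋-refl
  ⊕-assoc (a ∷ p) (b ∷ q) (d ∷ r) = ∷≈∷ (+-assoc a b d) (⊕-assoc p q r)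

  -- The zero polynomial is represented by lists of zeros of every length; `p ≋ []` covers them all,
  -- and congruence of addition rests on this case.
  ⊕-zeroˡ : ∀ {p} q → p ≋ [] → p ⊕ q ≋ q
  ⊕-zeroˡ q       []≈[]        = ≋-refl
  ⊕-zeroˡ []      (∷≈[] a≈0 e) = ∷≈[] a≈0 e
  ⊕-zeroˡ (b ∷ q) (∷≈[] a≈0 e) = ∷≈∷ (trans (+-congʳ a≈0) (+-identityˡ b)) (⊕-zeroˡ q e)

  ⊕-congˡ : ∀ {p p′} q → p ≋ p′ → p ⊕ q ≋ p′ ⊕ q
  ⊕-congˡ q       []≈[]          = ≋-refl
  ⊕-congˡ q       e@([]≈∷ _ _)   = ≋-sym (⊕-zeroˡ q (≋-sym e))
  ⊕-congˡ q       e@(∷≈[] _ _)   = ⊕-zeroˡ q e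
  ⊕-congˡ []      e@(∷≈∷ _ _)    = e
  ⊕-congˡ (b ∷ q) (∷≈∷ a≈a′ e)   = ∷≈∷ (+-congʳ a≈a′) (⊕-congˡ q e)

  ⊕-cong : ∀ {p p′ q q′} → p ≋ p′ → q ≋ q′ → p ⊕ q ≋ p′ ⊕ q′
  ⊕-cong {p} {p′} {q} {q′} e f =
    ≋-trans (⊕-congˡ q e) (≋-trans (⊕-comm p′ q) (≋-trans (⊕-congˡ p′ f) (⊕-comm q′ p′)))

  ⊖-cong : ∀ {p q} → p ≋ q → ⊖ p ≋ ⊖ q
  ⊖-cong []≈[]        = []≈[]
  ⊖-cong ([]≈∷ b≈0 e) = []≈∷ (trans (-‿cong b≈0) -0#≈0#) (⊖-cong e)
  ⊖-cong (∷≈[] a≈0 e) = ∷≈[] (trans (-‿cong a≈0) -0#≈0#) (⊖-cong e)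
  ⊖-cong (∷≈∷ a≈b e)  = ∷≈∷ (-‿cong a≈b) (⊖-cong e)

  ⊖-inverseˡ : ∀ p → (⊖ p) ⊕ p ≋ []
  ⊖-inverseˡ []      = []≈[]
  ⊖-inverseˡ (a ∷ p) = ∷≈[] (-‿inverseˡ a) (⊖-inverseˡ p)

  ·-cong : ∀ {a b p q} → a ≈ b → p ≋ q → a · p ≋ b · q
  ·-cong a≈b []≈[]        = []≈[]
  ·-cong a≈b ([]≈∷ c≈0 e) = []≈∷ (trans (*-congˡ c≈0) (zeroʳ _)) (·-cong a≈b e)
  ·-cong a≈b (∷≈[] c≈0 e) = ∷≈[] (trans (*-congˡ c≈0) (zeroʳ _)) (·-cong a≈b e)
  ·-cong a≈b (∷≈∷ c≈d e)  = ∷≈∷ (*-cong a≈b c≈d) (·-cong a≈b e)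

  ·-distribˡ : ∀ a p q → a · (p ⊕ q) ≋ a · p ⊕ a · q
  ·-distribˡ a []      q       = ≋-refl
  ·-distribˡ a (b ∷ p) []      = ≋-refl
  ·-distribˡ a (b ∷ p) (d ∷ q) = ∷≈∷ (distribˡ a b d) (·-distribˡ a p q)

  ·-distribʳ : ∀ a b p → (a + b) · p ≋ a · p ⊕ b · p
  ·-distribʳ a b []      = []≈[]
  ·-distribʳ a b (d ∷ p) = ∷≈∷ (distribʳ d a b) (·-distribʳ a b p)

  ·-assoc : ∀ a b p → (a * b) · p ≋ a · (b · p)
  ·-assoc a b []      = []≈[]
  ·-assoc a b (d ∷ p) = ∷≈∷ (*-assoc a b d) (·-assoc a b p)

  ·-identity : ∀ p → 1# · p ≋ p
  ·-identity []      = []≈[]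
  ·-identity (a ∷ p) = ∷≈∷ (*-identityˡ a) (·-identity p)

  ·-zero : ∀ p → 0# · p ≋ []
  ·-zero []      = []≈[]
  ·-zero (a ∷ p) = ∷≈[] (zeroˡ a) (·-zero p)

  shift-cong : ∀ {p q} → p ≋ q → 0# ∷ p ≋ 0# ∷ q
  shift-cong = ∷≈∷ refl

  ⊛-congʳ : ∀ p {q q′} → q ≋ q′ → p ⊛ q ≋ p ⊛ q′
  ⊛-congʳ []      e = []≈[]
  ⊛-congʳ (a ∷ p) e = ⊕-cong (·-cong refl e) (shift-cong (⊛-congʳ p e))

  ⊛-zeroʳ : ∀ p → p ⊛ [] ≋ []
  ⊛-zeroʳ []      = []≈[]
  ⊛-zeroʳ (a ∷ p) = ∷≈[] refl (⊛-zeroʳ p)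

  ⊕-interchange : ∀ p q r s → (p ⊕ q) ⊕ (r ⊕ s) ≋ (p ⊕ r) ⊕ (q ⊕ s)
  ⊕-interchange p q r s =
    ≋-trans (⊕-assoc p q (r ⊕ s)) (≋-trans (⊕-cong (≋-refl {p})
      (≋-trans (≋-sym (⊕-assoc q r s)) (≋-trans (⊕-congˡ s (⊕-comm q r)) (⊕-assoc r q s))))
      (≋-sym (⊕-assoc p r (q ⊕ s))))

  -- The product recurses on its left factor; this mirror recursion on the right factor yields
  -- commutativity.
  ⊛-∷ : ∀ p b q → p ⊛ (b ∷ q) ≋ b · p ⊕ (0# ∷ p ⊛ q)
  ⊛-∷ []      b q = []≈∷ refl []≈[]
  ⊛-∷ (a ∷ p) b q = ∷≈∷ (+-congʳ (*-comm a b)) (≋-trans (⊕-cong (≋-refl {a · q}) (⊛-∷ p b q))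
    (≋-trans (≋-sym (⊕-assoc (a · q) (b · p) (0# ∷ p ⊛ q)))
    (≋-trans (⊕-congˡ (0# ∷ p ⊛ q) (⊕-comm (a · q) (b · p))) (⊕-assoc (b · p) (a · q) (0# ∷ p ⊛ q)))))

  ⊛-comm : ∀ p q → p ⊛ q ≋ q ⊛ p
  ⊛-comm []      q = ≋-sym (⊛-zeroʳ q)
  ⊛-comm (a ∷ p) q = ≋-trans (⊕-cong ≋-refl (shift-cong (⊛-comm p q))) (≋-sym (⊛-∷ q a p))

  ⊛-cong : ∀ {p p′ q q′} → p ≋ p′ → q ≋ q′ → p ⊛ q ≋ p′ ⊛ q′
  ⊛-cong {p} {p′} {q} {q′} e f =
    ≋-trans (⊛-congʳ p f) (≋-trans (⊛-comm p q′) (≋-trans (⊛-congʳ q′ e) (⊛-comm q′ p′)))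

  ⊛-distribˡ : ∀ p q r → p ⊛ (q ⊕ r) ≋ p ⊛ q ⊕ p ⊛ r
  ⊛-distribˡ []      q r = []≈[]
  ⊛-distribˡ (a ∷ p) q r = ≋-trans
    (⊕-cong (·-distribˡ a q r) (≋-trans (shift-cong (⊛-distribˡ p q r)) (∷≈∷ (sym (+-identityˡ 0#)) ≋-refl)))
    (⊕-interchange (a · q) (a · r) (0# ∷ p ⊛ q) (0# ∷ p ⊛ r))

  ⊛-distribʳ : ∀ p q r → (q ⊕ r) ⊛ p ≋ q ⊛ p ⊕ r ⊛ p
  ⊛-distribʳ p q r = ≋-trans (⊛-comm (q ⊕ r) p)
    (≋-trans (⊛-distribˡ p q r) (⊕-cong (⊛-comm p q) (⊛-comm p r)))

  ·-⊛ : ∀ a p q → (a · p) ⊛ q ≋ a · (p ⊛ q)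
  ·-⊛ a []      q = []≈[]
  ·-⊛ a (b ∷ p) q = ≋-trans
    (⊕-cong (·-assoc a b q) (∷≈∷ (sym (zeroʳ a)) (·-⊛ a p q)))
    (≋-sym (·-distribˡ a (b · q) (0# ∷ p ⊛ q)))

  shift-⊛ : ∀ p q → (0# ∷ p) ⊛ q ≋ 0# ∷ p ⊛ q
  shift-⊛ p q = ⊕-zeroˡ (0# ∷ p ⊛ q) (·-zero q)

  ⊛-assoc : ∀ p q r → (p ⊛ q) ⊛ r ≋ p ⊛ (q ⊛ r)
  ⊛-assoc []      q r = []≈[]
  ⊛-assoc (a ∷ p) q r = ≋-trans (⊛-distribʳ r (a · q) (0# ∷ p ⊛ q))
    (⊕-cong (·-⊛ a q r) (≋-trans (shift-⊛ (p ⊛ q) r) (shift-cong (⊛-assoc p q r))))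

  C : Carrier → Poly ℝ
  C a = a ∷ []

  X : Poly ℝ
  X = 0# ∷ 1# ∷ []

  C-⊛ : ∀ a p → C a ⊛ p ≋ a · p
  C-⊛ a p = ≋-trans (⊕-comm (a · p) (0# ∷ [])) (⊕-zeroˡ (a · p) (∷≈[] refl []≈[]))

  ⊛-identityˡ : ∀ p → C 1# ⊛ p ≋ p
  ⊛-identityˡ p = ≋-trans (C-⊛ 1# p) (·-identity p)

  X-⊛ : ∀ p → X ⊛ p ≋ 0# ∷ p
  X-⊛ p = ≋-trans (shift-⊛ (C 1#) p) (shift-cong (⊛-identityˡ p))

  polyRing : CommutativeRing c (c ⊔ ℓ)
  polyRing = record
    { Carrier = Poly ℝ ; _≈_ = _≋_ ; _+_ = _⊕_ ; _*_ = _⊛_ ; -_ = ⊖_ ; 0# = [] ; 1# = C 1#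
    ; isCommutativeRing = record
      { isRing = record
        { +-isAbelianGroup = record
          { isGroup = record
            { isMonoid = record
              { isSemigroup = record
                { isMagma = record
                  { isEquivalence = record { refl = ≋-refl ; sym = ≋-sym ; trans = ≋-trans }
                  ; ∙-cong = ⊕-cong }
                ; assoc = ⊕-assoc }
              ; identity = (λ _ → ≋-refl) , ⊕-identityʳ }
            ; inverse = ⊖-inverseˡ , (λ p → ≋-trans (⊕-comm p (⊖ p)) (⊖-inverseˡ p))
            ; ⁻¹-cong = ⊖-cong }
          ; comm = ⊕-comm }
        ; *-cong = ⊛-cong
        ; *-assoc = ⊛-assoc
        ; *-identity = ⊛-identityˡ , (λ p → ≋-trans (⊛-comm p (C 1#)) (⊛-identityˡ p))
        ; distrib = ⊛-distribˡ , ⊛-distribʳ }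
      ; *-comm = ⊛-comm } }

  private
    module 𝒫 = CommutativeRing polyRing
    module 𝒫-Ring = Algebra.Properties.Ring 𝒫.ring
    module 𝒫-Solver = Algebra.Solver.Ring.NaturalCoefficients.Default 𝒫.commutativeSemiring
    module 𝒫-Reasoning = Relation.Binary.Reasoning.Setoid 𝒫.setoid
    module ℕ-Sum = Algebra.Properties.CommutativeMonoid.Sum ℕ.+-0-commutativeMonoid
  open Algebra.Properties.CommutativeMonoid.Sum 𝒫.+-commutativeMonoid using (sum; sum-cong-≋; ∑-distrib-+; sum-replicate-zero)
  open SumsOfSquares polyRing

  -- The recurrence of the matching polynomial

  fromℕ-+ : ∀ a b → fromℕ ℝ (a ℕ.+ b) ≈ fromℕ ℝ a + fromℕ ℝ b
  fromℕ-+ zero    b = sym (+-identityˡ _)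
  fromℕ-+ (suc a) b = trans (+-congˡ (fromℕ-+ a b)) (sym (+-assoc _ _ _))

  monomial-cong : ∀ {a b} k → a ≈ b → monomial ℝ a k ≋ monomial ℝ b k
  monomial-cong zero    a≈b = ∷≈∷ a≈b []≈[]
  monomial-cong (suc k) a≈b = ∷≈∷ refl (monomial-cong k a≈b)

  monomial-+ : ∀ a b k → monomial ℝ (a + b) k ≋ monomial ℝ a k ⊕ monomial ℝ b k
  monomial-+ a b zero    = ≋-refl
  monomial-+ a b (suc k) = ∷≈∷ (sym (+-identityˡ 0#)) (monomial-+ a b k)

  monomial-0 : ∀ {a} k → a ≈ 0# → monomial ℝ a k ≋ []
  monomial-0 zero    a≈0 = ∷≈[] a≈0 []≈[]
  monomial-0 (suc k) a≈0 = ∷≈[] refl (monomial-0 k a≈0)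

  -- The exponents need to agree only where `b` holds; elsewhere the count is 0 and the monomial of
  -- exponent `e` that it stands for vanishes.
  monomial-sum : ∀ {n} (b : Fin n → Bool) (N E : Fin n → ℕ) s e → (∀ v → b v ≡ true → E v ≡ e) →
    sum (λ v → if b v then monomial ℝ (s * fromℕ ℝ (N v)) (E v) else []) ≋
    monomial ℝ (s * fromℕ ℝ (ℕ-Sum.sum (λ v → if b v then N v else 0))) e
  monomial-sum {zero}  b N E s e h = ≋-sym (monomial-0 e (zeroʳ s))
  monomial-sum {suc n} b N E s e h = ≋-trans
    (⊕-cong first (monomial-sum (b ∘ suc) (N ∘ suc) (E ∘ suc) s e (h ∘ suc)))
    (≋-sym (≋-trans (monomial-cong e (trans (*-congˡ (fromℕ-+ N₀ N⁺)) (distribˡ s _ _)))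
                    (monomial-+ (s * fromℕ ℝ N₀) (s * fromℕ ℝ N⁺) e)))
    where
    N₀ = if b zero then N zero else 0
    N⁺ = ℕ-Sum.sum (λ v → if b (suc v) then N (suc v) else 0)
    first : (if b zero then monomial ℝ (s * fromℕ ℝ (N zero)) (E zero) else []) ≋ monomial ℝ (s * fromℕ ℝ N₀) e
    first with b zero in eq
    ... | true  rewrite h zero eq = ≋-refl
    ... | false = ≋-sym (monomial-0 e (zeroʳ s))

  -- The bound is free because the polynomials in the recurrence have different numbers of terms;
  -- `rsum-extend` pads them with vanishing terms to suitable bounds.
  rsum : (ℕ → Poly ℝ) → ℕ → Poly ℝ
  rsum F zero    = []
  rsum F (suc m) = F 0 ⊕ rsum (F ∘ suc) m

  rsum-applyUpTo : ∀ (F : ℕ → Poly ℝ) g m → foldr _⊕_ [] (map F (applyUpTo g m)) ≡ rsum (F ∘ g) m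
  rsum-applyUpTo F g zero    = ≡.refl
  rsum-applyUpTo F g (suc m) = ≡.cong (F (g 0) ⊕_) (rsum-applyUpTo F (g ∘ suc) m)

  rsum-cong : ∀ {F H : ℕ → Poly ℝ} → (∀ r → F r ≋ H r) → ∀ m → rsum F m ≋ rsum H m
  rsum-cong h zero    = []≈[]
  rsum-cong h (suc m) = ⊕-cong (h 0) (rsum-cong (h ∘ suc) m)

  rsum-0 : ∀ {F : ℕ → Poly ℝ} → (∀ r → F r ≋ []) → ∀ m → rsum F m ≋ []
  rsum-0 h zero    = []≈[]
  rsum-0 h (suc m) = ≋-trans (⊕-zeroˡ _ (h 0)) (rsum-0 (h ∘ suc) m)

  rsum-extend : ∀ {F : ℕ → Poly ℝ} {m B} → m ℕ.≤ B → (∀ r → m ℕ.≤ r → F r ≋ []) → rsum F m ≋ rsum F B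
  rsum-extend {B = B} z≤n       h = ≋-sym (rsum-0 (λ r → h r z≤n) B)
  rsum-extend         (s≤s m≤B) h = ⊕-cong ≋-refl (rsum-extend m≤B (λ r m≤r → h (suc r) (s≤s m≤r)))

  rsum-⊕ : ∀ (F H : ℕ → Poly ℝ) m → rsum (λ r → F r ⊕ H r) m ≋ rsum F m ⊕ rsum H m
  rsum-⊕ F H zero    = []≈[]
  rsum-⊕ F H (suc m) = ≋-trans (⊕-cong ≋-refl (rsum-⊕ (F ∘ suc) (H ∘ suc) m))
    (⊕-interchange (F 0) (H 0) (rsum (F ∘ suc) m) (rsum (H ∘ suc) m))

  rsum-⊛ : ∀ p (F : ℕ → Poly ℝ) m → rsum (λ r → p ⊛ F r) m ≋ p ⊛ rsum F m
  rsum-⊛ p F zero    = ≋-sym (⊛-zeroʳ p)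
  rsum-⊛ p F (suc m) = ≋-trans (⊕-cong ≋-refl (rsum-⊛ p (F ∘ suc) m)) (≋-sym (⊛-distribˡ p (F 0) (rsum (F ∘ suc) m)))

  sum-rsum : ∀ {n} (b : Fin n → Bool) (F : Fin n → ℕ → Poly ℝ) m →
    sum (λ v → if b v then rsum (F v) m else []) ≋ rsum (λ r → sum (λ v → if b v then F v r else [])) m
  sum-rsum {n} b F zero = ≋-trans (sum-cong-≋ vanish) (sum-replicate-zero n)
    where
    vanish : ∀ v → (if b v then [] else []) ≋ []
    vanish v with b v
    ... | true  = []≈[]
    ... | false = []≈[]
  sum-rsum b F (suc m) = ≋-trans (sum-cong-≋ split)
    (≋-trans (∑-distrib-+ (λ v → if b v then F v 0 else []) (λ v → if b v then rsum (F v ∘ suc) m else []))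
      (⊕-cong ≋-refl (sum-rsum b (λ v → F v ∘ suc) m)))
    where
    split : ∀ v → (if b v then rsum (F v) (suc m) else []) ≋
      (if b v then F v 0 else []) ⊕ (if b v then rsum (F v ∘ suc) m else [])
    split v with b v
    ... | true  = ≋-refl
    ... | false = []≈[]

  module _ {n} (G : Graph n) where

    term : Subset n → ℕ → Poly ℝ
    term S r = monomial ℝ (sign ℝ r * fromℕ ℝ (numMatchings G S r)) (∣ S ∣ ∸ (2 ℕ.* r))

    numMatchings-large : ∀ S r → ∣ S ∣ ℕ.< 2 ℕ.* r → fromℕ ℝ (numMatchings G S r) ≈ 0#
    numMatchings-large S r lt rewrite numMatchings-vanish G ∣ S ∣ S r ≡.refl lt = refl

    ⌊/2⌋<⇒<2* : ∀ {m} r → ⌊ m /2⌋ ℕ.< r → m ℕ.< 2 ℕ.* r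
    ⌊/2⌋<⇒<2* {m} r lt = ℕ.≰⇒> λ 2r≤m → ℕ.<⇒≱ lt (≡.subst (ℕ._≤ ⌊ m /2⌋)
      (≡.trans (≡.cong (λ k → ⌊ r ℕ.+ k /2⌋) (ℕ.+-identityʳ r)) (≡.sym (ℕ.n≡⌊n+n/2⌋ r))) (ℕ.⌊n/2⌋-mono 2r≤m))

    μ-rsum : ∀ S B → suc ⌊ ∣ S ∣ /2⌋ ℕ.≤ B → μ ℝ G S ≋ rsum (term S) B
    μ-rsum S B le = ≋-trans (𝒫.reflexive (rsum-applyUpTo (term S) id (suc ⌊ ∣ S ∣ /2⌋)))
      (rsum-extend le (λ r lt → monomial-0 _ (trans (*-congˡ (numMatchings-large S r (⌊/2⌋<⇒<2* r lt))) (zeroʳ _))))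

    module _ (S : Subset n) (u : Fin n) (Su : lookup S u ≡ true) where
      private
        S−u = S ⊝ u
        isNbr : Fin n → Bool
        isNbr v = adj G u v ∧ lookup S−u v

      -- If 2r is at most the size of `S−u`, the exponent for `S` is one larger than that for `S−u`.
      -- Otherwise the subtraction for `S−u` truncates, but then the coefficient is 0.
      term-X : ∀ r → monomial ℝ (sign ℝ r * fromℕ ℝ (numMatchings G S−u r)) (∣ S ∣ ∸ 2 ℕ.* r) ≋ X ⊛ term S−u r
      term-X r with 2 ℕ.* r ℕ.≤? ∣ S−u ∣
      ... | yes le rewrite ∣delete∣ S u Su | ℕ.+-∸-assoc 1 le = ≋-sym (X-⊛ _)
      ... | no ≰ = ≋-trans (monomial-0 _ coeff≈0) (≋-sym (≋-trans (⊛-congʳ X (monomial-0 _ coeff≈0)) (⊛-zeroʳ X)))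
        where
        coeff≈0 : sign ℝ r * fromℕ ℝ (numMatchings G S−u r) ≈ 0#
        coeff≈0 = trans (*-congˡ (numMatchings-large S−u r (ℕ.≰⇒> ≰))) (zeroʳ _)

      term-zero : term S 0 ≋ X ⊛ term S−u 0
      term-zero = ≋-trans
        (𝒫.reflexive (≡.cong (λ k → monomial ℝ (1# * fromℕ ℝ k) ∣ S ∣)
          (≡.trans (matchings-zero (edges G S)) (≡.sym (matchings-zero (edges G S−u))))))
        (term-X 0)

      isNbr⇒∣∣ : ∀ v → isNbr v ≡ true → ∣ S ∣ ≡ suc (suc ∣ S−u ⊝ v ∣)
      isNbr⇒∣∣ v eq with adj G u v
      ... | true = ≡.trans (∣delete∣ S u Su) (≡.cong suc (∣delete∣ S−u v eq))

      exponent : ∀ r v → isNbr v ≡ true → ∣ S−u ⊝ v ∣ ∸ 2 ℕ.* r ≡ ∣ S ∣ ∸ 2 ℕ.* suc r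
      exponent r v eq rewrite isNbr⇒∣∣ v eq | ℕ.+-suc r (r ℕ.+ 0) = ≡.refl

      -- An (r+1)-matching through `u` leaves an r-matching after both ends of its edge at `u` are
      -- deleted. The neighbour terms therefore enter with shifted index, opposite sign and, two
      -- vertices being gone, the same exponent, and cancel this part of the count.
      term-suc : ∀ r → term S (suc r) ⊕ sum (λ v → if isNbr v then term (S−u ⊝ v) r else []) ≋ X ⊛ term S−u (suc r)
      term-suc r = begin
        term S (suc r) ⊕ sum (λ v → if isNbr v then term (S−u ⊝ v) r else [])
          ≈⟨ ⊕-cong (monomial-cong e coeff) (monomial-sum isNbr (λ v → numMatchings G (S−u ⊝ v) r) (λ v → ∣ S−u ⊝ v ∣ ∸ 2 ℕ.* r) s e (exponent r)) ⟩
        monomial ℝ (- s * N₁ + - s * N₂) e ⊕ monomial ℝ (s * N₂) e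
          ≈⟨ monomial-+ (- s * N₁ + - s * N₂) (s * N₂) e ⟨
        monomial ℝ ((- s * N₁ + - s * N₂) + s * N₂) e
          ≈⟨ monomial-cong e cancel ⟩
        monomial ℝ (- s * N₁) e
          ≈⟨ term-X (suc r) ⟩
        X ⊛ term S−u (suc r) ∎
        where
        open 𝒫-Reasoning
        s = sign ℝ r
        e = ∣ S ∣ ∸ 2 ℕ.* suc r
        k₂ = ℕ-Sum.sum (λ v → if isNbr v then numMatchings G (S−u ⊝ v) r else 0)
        N₁ = fromℕ ℝ (numMatchings G S−u (suc r))
        N₂ = fromℕ ℝ k₂
        coeff : - s * fromℕ ℝ (numMatchings G S (suc r)) ≈ - s * N₁ + - s * N₂
        coeff rewrite numMatchings-vertex G S u Su r =
          trans (*-congˡ (fromℕ-+ (numMatchings G S−u (suc r)) k₂)) (distribˡ (- s) N₁ N₂)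
        cancel : (- s * N₁ + - s * N₂) + s * N₂ ≈ - s * N₁
        cancel = trans (+-assoc _ _ _) (trans (+-congˡ
          (trans (+-congʳ (sym (-‿distribˡ-* s N₂))) (-‿inverseˡ (s * N₂)))) (+-identityʳ _))

    μ-recurrence : Recurrence (adj G) (λ _ → X) (μ ℝ G)
    -- The index shift leaves the neighbour sums one term fewer than the other two sums; `n` terms
    -- suffice for them because two vertices have been deleted.
    μ-recurrence S u Su = begin
      μ ℝ G S ⊕ neighbourSum (adj G) (μ ℝ G) S u
        ≈⟨ ⊕-cong (μ-rsum S (suc n) (s≤s (ℕ.≤-trans (ℕ.⌊n/2⌋≤n ∣ S ∣) (∣p∣≤n S))))
             (≋-trans (sum-cong-≋ expand) (sum-rsum isNbr (λ v → term (S ⊝ u ⊝ v)) n)) ⟩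
      (term S 0 ⊕ rsum (term S ∘ suc) n) ⊕ rsum nbrTerms n
        ≈⟨ ⊕-assoc (term S 0) (rsum (term S ∘ suc) n) (rsum nbrTerms n) ⟩
      term S 0 ⊕ (rsum (term S ∘ suc) n ⊕ rsum nbrTerms n)
        ≈⟨ ⊕-cong (term-zero S u Su) (≋-trans (≋-sym (rsum-⊕ (term S ∘ suc) nbrTerms n)) (rsum-cong (term-suc S u Su) n)) ⟩
      X ⊛ term (S ⊝ u) 0 ⊕ rsum (λ r → X ⊛ term (S ⊝ u) (suc r)) n
        ≈⟨ rsum-⊛ X (term (S ⊝ u)) (suc n) ⟩
      X ⊛ rsum (term (S ⊝ u)) (suc n)
        ≈⟨ ⊛-congʳ X (μ-rsum (S ⊝ u) (suc n) (s≤s (ℕ.≤-trans (ℕ.⌊n/2⌋≤n ∣ S ⊝ u ∣) (∣p∣≤n (S ⊝ u))))) ⟨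
      X ⊛ μ ℝ G (S ⊝ u) ∎
      where
      open 𝒫-Reasoning
      isNbr : Fin n → Bool
      isNbr v = adj G u v ∧ lookup (S ⊝ u) v
      nbrTerms : ℕ → Poly ℝ
      nbrTerms r = sum (λ v → if isNbr v then term (S ⊝ u ⊝ v) r else [])
      expand : ∀ v → (if isNbr v then μ ℝ G (S ⊝ u ⊝ v) else []) ≋ (if isNbr v then rsum (term (S ⊝ u ⊝ v)) n else [])
      expand v with isNbr v in eq
      ... | false = []≈[]
      ... | true  = μ-rsum (S ⊝ u ⊝ v) n (ℕ.≤-trans (s≤s (ℕ.⌊n/2⌋≤n ∣ S ⊝ u ⊝ v ∣))
        (ℕ.≤-trans (ℕ.n≤1+n _) (≡.subst (ℕ._≤ n) (isNbr⇒∣∣ S u Su v eq) (∣p∣≤n S))))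

    μ-empty : ∀ S → (∀ i → lookup S i ≡ false) → μ ℝ G S ≋ C 1#
    μ-empty S none rewrite ∣empty∣ S none | matchings-zero (edges G S) =
      ∷≈∷ (trans (*-identityˡ _) (+-identityʳ 1#)) []≈[]

  ⊕-solve : ∀ {p q r} → p ⊕ q ≋ r → p ≋ r ⊕ ⊖ q
  ⊕-solve {p} {q} {r} e = begin
    p                 ≈⟨ ⊕-identityʳ p ⟨
    p ⊕ []            ≈⟨ ⊕-cong (≋-refl {p}) (𝒫.-‿inverseʳ q) ⟨
    p ⊕ (q ⊕ ⊖ q)     ≈⟨ ⊕-assoc p q (⊖ q) ⟨
    (p ⊕ q) ⊕ ⊖ q     ≈⟨ ⊕-congˡ (⊖ q) e ⟩
    r ⊕ ⊖ q           ∎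
    where open 𝒫-Reasoning

  -- Orders of vanishing at θ

  module _ (θ : Carrier) where

    ev : Poly ℝ → Carrier
    ev []      = 0#
    ev (a ∷ p) = a + θ * ev p

    ev-cong : ∀ {p q} → p ≋ q → ev p ≈ ev q
    ev-cong []≈[] = refl
    ev-cong ([]≈∷ b≈0 e) = sym (trans (+-cong b≈0 (trans (*-congˡ (sym (ev-cong e))) (zeroʳ θ))) (+-identityˡ 0#))
    ev-cong (∷≈[] a≈0 e) = trans (+-cong a≈0 (trans (*-congˡ (ev-cong e)) (zeroʳ θ))) (+-identityˡ 0#)
    ev-cong (∷≈∷ a≈b e) = +-cong a≈b (*-congˡ (ev-cong e))

    ev-⊕ : ∀ p q → ev (p ⊕ q) ≈ ev p + ev q
    ev-⊕ []      q       = sym (+-identityˡ _)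
    ev-⊕ (a ∷ p) []      = sym (+-identityʳ _)
    ev-⊕ (a ∷ p) (b ∷ q) = trans (+-congˡ (*-congˡ (ev-⊕ p q)))
      (solve 5 (λ a b t x y → (a :+ b) :+ t :* (x :+ y) := (a :+ t :* x) :+ (b :+ t :* y)) refl a b θ (ev p) (ev q))
      where open ℝ-Solver

    ev-· : ∀ a p → ev (a · p) ≈ a * ev p
    ev-· a []      = sym (zeroʳ a)
    ev-· a (b ∷ p) = trans (+-congˡ (*-congˡ (ev-· a p)))
      (solve 4 (λ a b t x → (a :* b) :+ t :* (a :* x) := a :* (b :+ t :* x)) refl a b θ (ev p))
      where open ℝ-Solver

    ev-⊛ : ∀ p q → ev (p ⊛ q) ≈ ev p * ev q
    ev-⊛ []      q = sym (zeroˡ _)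
    ev-⊛ (a ∷ p) q = trans (ev-⊕ (a · q) (0# ∷ p ⊛ q))
      (trans (+-cong (ev-· a q) (trans (+-identityˡ _) (*-congˡ (ev-⊛ p q))))
        (solve 4 (λ a y t x → a :* y :+ t :* (x :* y) := (a :+ t :* x) :* y) refl a (ev q) θ (ev p)))
      where open ℝ-Solver

    ev-⊖ : ∀ p → ev (⊖ p) ≈ - ev p
    ev-⊖ []      = sym -0#≈0#
    ev-⊖ (a ∷ p) = trans (+-congˡ (trans (*-congˡ (ev-⊖ p)) (sym (-‿distribʳ-* θ (ev p)))))
      (-‿+-comm a (θ * ev p))

    ev-C : ∀ a → ev (C a) ≈ a
    ev-C a = trans (+-congˡ (zeroʳ θ)) (+-identityʳ a)

    private
      f : Poly ℝ
      f = X-θ ℝ θ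

      f^ : ℕ → Poly ℝ
      f^ k = _^ₚ_ ℝ f k

    ev-f : ev f ≈ 0#
    ev-f = trans (+-congˡ (trans (*-congˡ (ev-C 1#)) (*-identityʳ θ))) (-‿inverseˡ θ)

    f-⊛ : ∀ p → f ⊛ p ≋ (- θ) · p ⊕ (0# ∷ p)
    f-⊛ p = ⊕-cong ≋-refl (∷≈∷ refl (⊛-identityˡ p))

    -- For `b = 0` the hypothesis says that x - θ times `q` is zero. The general `b` is the
    -- coefficient carried over from the previous position, and the coefficients are found to vanish
    -- from the top downwards.
    f-⊛-zero : ∀ b q → (- θ) · q ⊕ (b ∷ q) ≋ [] → b ≈ 0# × q ≋ []
    f-⊛-zero b []      (∷≈[] b≈0 _) = b≈0 , []≈[]
    f-⊛-zero b (d ∷ q) (∷≈[] e rest) with f-⊛-zero d q rest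
    ... | d≈0 , q≋[] =
      trans (trans (sym (+-identityˡ b)) (+-congʳ (sym (trans (*-congˡ d≈0) (zeroʳ (- θ)))))) e , ∷≈[] d≈0 q≋[]

    f-cancel : ∀ {p q} → f ⊛ p ≋ f ⊛ q → p ≋ q
    f-cancel {p} {q} e = begin
      p                   ≈⟨ ⊕-identityʳ p ⟨
      p ⊕ []              ≈⟨ ⊕-cong (≋-refl {p}) (⊖-inverseˡ q) ⟨
      p ⊕ (⊖ q ⊕ q)       ≈⟨ ⊕-assoc p (⊖ q) q ⟨
      (p ⊕ ⊖ q) ⊕ q       ≈⟨ ⊕-zeroˡ q p-q≋0 ⟩
      q                   ∎
      where
      open 𝒫-Reasoning
      p-q≋0 : p ⊕ ⊖ q ≋ []
      p-q≋0 = proj₂ (f-⊛-zero 0# (p ⊕ ⊖ q) (≋-trans (≋-sym (f-⊛ (p ⊕ ⊖ q))) (begin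
        f ⊛ (p ⊕ ⊖ q)         ≈⟨ ⊛-distribˡ f p (⊖ q) ⟩
        f ⊛ p ⊕ f ⊛ (⊖ q)     ≈⟨ ⊕-congˡ (f ⊛ (⊖ q)) e ⟩
        f ⊛ q ⊕ f ⊛ (⊖ q)     ≈⟨ ⊛-distribˡ f q (⊖ q) ⟨
        f ⊛ (q ⊕ ⊖ q)         ≈⟨ ⊛-congʳ f (𝒫.-‿inverseʳ q) ⟩
        f ⊛ []                ≈⟨ ⊛-zeroʳ f ⟩
        []                    ∎)))

    f^-cancel : ∀ k {p q} → f^ k ⊛ p ≋ f^ k ⊛ q → p ≋ q
    f^-cancel zero    {p} {q} e = ≋-trans (≋-sym (⊛-identityˡ p)) (≋-trans e (⊛-identityˡ q))
    f^-cancel (suc k) {p} {q} e = f^-cancel k (f-cancel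
      (≋-trans (≋-sym (⊛-assoc f (f^ k) p)) (≋-trans e (⊛-assoc f (f^ k) q))))

    quot : Poly ℝ → Poly ℝ
    quot []          = []
    quot (a ∷ [])    = []
    quot (a ∷ b ∷ p) = ev (b ∷ p) ∷ quot (b ∷ p)

    -- Horner's scheme.
    quot-correct : ∀ p → p ≋ C (ev p) ⊕ ((- θ) · quot p ⊕ (0# ∷ quot p))
    quot-correct []          = []≈∷ (+-identityˡ 0#) []≈[]
    quot-correct (a ∷ [])    = ∷≈∷ (sym (trans (+-identityʳ _) (ev-C a))) []≈[]
    quot-correct (a ∷ b ∷ p) = ∷≈∷ head (begin
      b ∷ p                                 ≈⟨ quot-correct (b ∷ p) ⟩
      C e ⊕ ((- θ) · h ⊕ (0# ∷ h))          ≈⟨ solve 3 (λ x y z → x :+ (y :+ z) := y :+ (x :+ z)) ≋-refl (C e) ((- θ) · h) (0# ∷ h) ⟩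
      (- θ) · h ⊕ (C e ⊕ (0# ∷ h))          ≈⟨ ⊕-cong (≋-refl {(- θ) · h}) (∷≈∷ (+-identityʳ e) ≋-refl) ⟩
      (- θ) · h ⊕ (e ∷ h)                   ∎)
      where
      open 𝒫-Reasoning
      open 𝒫-Solver
      e = ev (b ∷ p)
      h = quot (b ∷ p)
      head : a ≈ (a + θ * e) + (- θ * e + 0#)
      head = sym (trans (+-congˡ (trans (+-identityʳ _) (sym (-‿distribˡ-* θ e))))
        (trans (+-assoc a (θ * e) (- (θ * e))) (trans (+-congˡ (-‿inverseʳ (θ * e))) (+-identityʳ a))))

    factor : ∀ p → ev p ≈ 0# → p ≋ f ⊛ quot p
    factor p e = ≋-trans (quot-correct p) (≋-trans (⊕-zeroˡ _ (∷≈[] e []≈[])) (≋-sym (f-⊛ (quot p))))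

    length-quot : ∀ a p → length (quot (a ∷ p)) ≡ length p
    length-quot a []      = ≡.refl
    length-quot a (b ∷ p) = ≡.cong suc (length-quot b p)

    -- p = a (x - θ)^k + higher powers of (x - θ), where a may vanish.
    record Lead (k : ℕ) (a : Carrier) (p : Poly ℝ) : Set (c ⊔ ℓ) where
      constructor lead
      field
        cofactor   : Poly ℝ
        factorises : p ≋ f^ k ⊛ cofactor
        value      : ev cofactor ≈ a

    lead-resp : ∀ {k a b p q} → a ≈ b → p ≋ q → Lead k a p → Lead k b q
    lead-resp a≈b p≋q (lead r e v) = lead r (≋-trans (≋-sym p≋q) e) (trans v a≈b)

    lead-0 : ∀ {k} → Lead k 0# []
    lead-0 {k} = lead [] (≋-sym (⊛-zeroʳ (f^ k))) refl

    lead-C : ∀ a → Lead 0 a (C a)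
    lead-C a = lead (C a) (≋-sym (⊛-identityˡ (C a))) (ev-C a)

    lead-⊕ : ∀ {k a b p q} → Lead k a p → Lead k b q → Lead k (a + b) (p ⊕ q)
    lead-⊕ {k} (lead r e v) (lead s e′ v′) =
      lead (r ⊕ s) (≋-trans (⊕-cong e e′) (≋-sym (⊛-distribˡ (f^ k) r s))) (trans (ev-⊕ r s) (+-cong v v′))

    f^-+ : ∀ k l → f^ (k ℕ.+ l) ≋ f^ k ⊛ f^ l
    f^-+ zero    l = ≋-sym (⊛-identityˡ (f^ l))
    f^-+ (suc k) l = ≋-trans (⊛-congʳ f (f^-+ k l)) (≋-sym (⊛-assoc f (f^ k) (f^ l)))

    lead-⊛ : ∀ {k l a b p q} → Lead k a p → Lead l b q → Lead (k ℕ.+ l) (a * b) (p ⊛ q)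
    lead-⊛ {k} {l} (lead r e v) (lead s e′ v′) = lead (r ⊛ s)
      (≋-trans (⊛-cong e e′) (≋-trans
        (solve 4 (λ x y z w → (x :* y) :* (z :* w) := (x :* z) :* (y :* w)) ≋-refl (f^ k) r (f^ l) s)
        (⊛-cong (≋-sym (f^-+ k l)) ≋-refl)))
      (trans (ev-⊛ r s) (*-cong v v′))
      where open 𝒫-Solver

    lead-⊖ : ∀ {k a p} → Lead k a p → Lead k (- a) (⊖ p)
    lead-⊖ {k} (lead r e v) = lead (⊖ r)
      (≋-trans (⊖-cong e) (PR.-‿distribʳ-* (f^ k) r)) (trans (ev-⊖ r) (-‿cong v))
      where module PR = Algebra.Properties.Ring 𝒫.ring

    -- One factor `f` moves into the cofactor, which then vanishes at θ. Thus `Lead k 0# p` is the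
    -- way to say that `p` vanishes to order greater than `k`.
    lead-pred : ∀ {k a p} → Lead (suc k) a p → Lead k 0# p
    lead-pred {k} (lead r e v) = lead (f ⊛ r)
      (≋-trans e (solve 3 (λ x y z → (x :* y) :* z := y :* (x :* z)) ≋-refl f (f^ k) r))
      (trans (ev-⊛ f r) (trans (*-congʳ ev-f) (zeroˡ _)))
      where open 𝒫-Solver

    lead-< : ∀ {k l a p} → k ℕ.< l → Lead l a p → Lead k 0# p
    lead-< {k} {suc l} k<l L with ℕ.m<1+n⇒m<n∨m≡n k<l
    ... | inj₁ k<l′   = lead-< k<l′ (lead-pred L)
    ... | inj₂ ≡.refl = lead-pred L

    lead-unique : ∀ {k a b p} → Lead k a p → Lead k b p → a ≈ b
    lead-unique {k} (lead r e v) (lead s e′ v′) =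
      trans (sym v) (trans (ev-cong (f^-cancel k (≋-trans (≋-sym e) e′))) v′)

    order-unique : ∀ {k l a b p} → ¬ (a ≈ 0#) → ¬ (b ≈ 0#) → Lead k a p → Lead l b p → k ≡ l
    order-unique {k} {l} a≉0 b≉0 L M with ℕ.<-cmp k l
    ... | tri< k<l _ _ = contradiction (lead-unique L (lead-< k<l M)) a≉0
    ... | tri≈ _ k≡l _ = k≡l
    ... | tri> _ _ l<k = contradiction (lead-unique M (lead-< l<k L)) b≉0

    HasOrder : ℕ → Poly ℝ → Set (c ⊔ ℓ)
    HasOrder k p = ∃ λ a → ¬ (a ≈ 0#) × Lead k a p

    lead-f⊛ : ∀ {k a p} → Lead k a p → Lead (suc k) a (f ⊛ p)
    lead-f⊛ {k} (lead r e v) = lead r (≋-trans (⊛-congʳ f e) (≋-sym (⊛-assoc f (f^ k) r))) v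

    -- Divide by `f` as long as the value at θ is 0. Each division shortens the list by one, so it
    -- stops at a nonzero value or at the empty list; in the latter case `p` is zero.
    zero-or-order : ∀ p → p ≋ [] ⊎ ∃ λ k → HasOrder k p
    zero-or-order p = go (length p) p ℕ.≤-refl
      where
      go : ∀ N p → length p ℕ.≤ N → p ≋ [] ⊎ ∃ λ k → HasOrder k p
      go N [] _ = inj₁ []≈[]
      go (suc N) p@(a ∷ p′) (s≤s len) with compare (ev p) 0#
      ... | tri< _ ≉0 _ = inj₂ (0 , ev p , ≉0 , lead p (≋-sym (⊛-identityˡ p)) refl)
      ... | tri> _ ≉0 _ = inj₂ (0 , ev p , ≉0 , lead p (≋-sym (⊛-identityˡ p)) refl)
      ... | tri≈ _ ≈0 _ with go N (quot p) (ℕ.≤-trans (ℕ.≤-reflexive (length-quot a p′)) len)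
      ...   | inj₁ q≋0 = inj₁ (≋-trans (factor p ≈0) (≋-trans (⊛-congʳ f q≋0) (⊛-zeroʳ f)))
      ...   | inj₂ (k , b , b≉0 , L) = inj₂ (suc k , b , b≉0 , lead-resp refl (≋-sym (factor p ≈0)) (lead-f⊛ L))

    HasOrder⇒Mult : ∀ {k p} → HasOrder k p → Mult ℝ θ p k
    HasOrder⇒Mult (a , a≉0 , L@(lead r e _)) =
      (r , e) , λ { (s , e′) → a≉0 (lead-unique L (lead-pred (lead s e′ refl))) }

    HasOrder-Mult-unique : ∀ {k l p} → HasOrder k p → Mult ℝ θ p l → k ≡ l
    HasOrder-Mult-unique {k} {l} (a , a≉0 , L) ((s , e) , ¬div) with ℕ.<-cmp k l
    ... | tri< k<l _ _ = contradiction (lead-unique L (lead-< k<l (lead s e refl))) a≉0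
    ... | tri≈ _ k≡l _ = k≡l
    ... | tri> _ _ l<k with ℕ.m≤n⇒m<n∨m≡n l<k
    ...   | inj₁ 1+l<k with lead r e′ _ ← lead-< 1+l<k L = contradiction (r , e′) ¬div
    ...   | inj₂ ≡.refl with lead r e′ _ ← L             = contradiction (r , e′) ¬div

    lead-X : Lead 0 θ X
    lead-X = lead X (≋-sym (⊛-identityˡ X)) (trans (+-identityˡ _) (trans (*-congˡ (ev-C 1#)) (*-identityʳ θ)))

    X≋f⊕Cθ : X ≋ f ⊕ C θ
    X≋f⊕Cθ = ∷≈∷ (sym (-‿inverseˡ θ)) ≋-refl

    -- The germ of r / q at θ, where q = a (x - θ)^K + …: either a simple pole with residue b / a > 0,
    -- or regular with value γ and derivative - d / a, the sign of which Sign controls.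
    data Ratio (Sign : Carrier → Set ℓ) (K : ℕ) (a : Carrier) (q r : Poly ℝ) : Set (c ⊔ ℓ) where
      pole    : ∀ {k b} → K ≡ suc k → Lead k b r → 0# < a * b → Ratio Sign K a q r
      regular : ∀ {d} γ z → r ⊕ z ≋ C γ ⊛ q → Lead (suc K) d z → Sign (a * d) → Ratio Sign K a q r

    Positive NonNegative : Carrier → Set ℓ
    Positive    x = 0# < x
    NonNegative x = 0# ≤ℝ x

    +-pos-nonNeg : ∀ {x y} → Positive x → NonNegative y → Positive (x + y)
    +-pos-nonNeg 0<x (inj₁ 0<y) = +-pos 0<x 0<y
    +-pos-nonNeg 0<x (inj₂ 0≈y) = <-respʳ (trans (sym (+-identityʳ _)) (+-congˡ 0≈y)) 0<x

    +-nonNeg : ∀ {x y} → NonNegative x → NonNegative y → NonNegative (x + y)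
    +-nonNeg (inj₁ 0<x) 0≤y        = inj₁ (+-pos-nonNeg 0<x 0≤y)
    +-nonNeg (inj₂ 0≈x) (inj₁ 0<y) = inj₁ (<-respʳ (trans (sym (+-identityˡ _)) (+-congʳ 0≈x)) 0<y)
    +-nonNeg (inj₂ 0≈x) (inj₂ 0≈y) = inj₂ (trans (sym (+-identityˡ 0#)) (+-cong 0≈x 0≈y))

    NonNegative-resp : ∀ {x y} → x ≈ y → NonNegative x → NonNegative y
    NonNegative-resp x≈y (inj₁ 0<x) = inj₁ (<-respʳ x≈y 0<x)
    NonNegative-resp x≈y (inj₂ 0≈x) = inj₂ (trans 0≈x x≈y)

    Ratio-weaken : ∀ {K a a′ q r} → a ≈ a′ → Ratio Positive K a q r → Ratio NonNegative K a′ q r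
    Ratio-weaken a≈a′ (pole eq L pos)       = pole eq L (<-respʳ (*-congʳ a≈a′) pos)
    Ratio-weaken a≈a′ (regular γ z e L pos) = regular γ z e L (inj₁ (<-respʳ (*-congʳ a≈a′) pos))

    -- Up to the higher-order term `z`, `r` is `γ` times `q`. The value `γ` may be 0, and then only
    -- an order greater than `K` is asserted.
    regular-lead : ∀ {K a d q r γ z} → Lead K a q → r ⊕ z ≋ C γ ⊛ q → Lead (suc K) d z → Lead K (γ * a) r
    regular-lead {γ = γ} Lq e Lz = lead-resp (+-identityʳ _) (≋-sym (⊕-solve e))
      (lead-⊕ (lead-⊛ (lead-C γ) Lq) (lead-pred (lead-⊖ Lz)))

    Ratio-zero : ∀ {K a q} → Ratio NonNegative K a q []
    Ratio-zero {a = a} {q} = regular 0# [] (≋-sym (≋-trans (C-⊛ 0# q) (·-zero q))) lead-0 (inj₂ (sym (zeroʳ a)))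

    -- Residues of equal sign cannot cancel, nor can derivatives of equal sign. Next to a pole,
    -- where the numerator has order one less than `K`, a regular summand of order at least `K` is
    -- negligible.
    Ratio-⊕ : ∀ {K a q r s} → Lead K a q →
      Ratio NonNegative K a q r → Ratio NonNegative K a q s → Ratio NonNegative K a q (r ⊕ s)
    Ratio-⊕ Lq (pole ≡.refl L pos) (pole ≡.refl L′ pos′) =
      pole ≡.refl (lead-⊕ L L′) (<-respʳ (sym (distribˡ _ _ _)) (+-pos pos pos′))
    Ratio-⊕ Lq (pole ≡.refl L pos) (regular γ z e L′ _) =
      pole ≡.refl (lead-resp (+-identityʳ _) ≋-refl (lead-⊕ L (lead-pred (regular-lead Lq e L′)))) pos
    Ratio-⊕ Lq (regular γ z e L′ _) (pole ≡.refl L pos) =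
      pole ≡.refl (lead-resp (+-identityˡ _) ≋-refl (lead-⊕ (lead-pred (regular-lead Lq e L′)) L)) pos
    Ratio-⊕ {q = q} {r} {s} Lq (regular γ z e L pos) (regular γ′ z′ e′ L′ pos′) =
      regular (γ + γ′) (z ⊕ z′)
        (≋-trans (⊕-interchange r s z z′) (≋-trans (⊕-cong e e′) (≋-sym (⊛-distribʳ q (C γ) (C γ′)))))
        (lead-⊕ L L′) (NonNegative-resp (sym (distribˡ _ _ _)) (+-nonNeg pos pos′))

    Ratio-sum : ∀ {n K a q} → Lead K a q → (b : Fin n → Bool) (r : Fin n → Poly ℝ) →
      (∀ v → b v ≡ true → Ratio NonNegative K a q (r v)) →
      Ratio NonNegative K a q (sum (λ v → if b v then r v else []))
    Ratio-sum {zero}  Lq b r h = Ratio-zero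
    Ratio-sum {suc n} Lq b r h = Ratio-⊕ Lq first (Ratio-sum Lq (b ∘ suc) (r ∘ suc) (h ∘ suc))
      where
      first : Ratio NonNegative _ _ _ (if b zero then r zero else [])
      first with b zero in eq
      ... | true  = h zero eq
      ... | false = Ratio-zero

    -- q / p = 1 / (x - r / q) inherits the dichotomy from r / q.
    Ratio-invert : ∀ {K a p q r} → ¬ (a ≈ 0#) → Lead K a q → Ratio NonNegative K a q r → p ⊕ r ≋ X ⊛ q →
      ∃₂ λ K′ a′ → ¬ (a′ ≈ 0#) × Lead K′ a′ p × Ratio Positive K′ a′ p q
    -- A pole of r / q is a zero of q / p: here the value is 0, the remainder is `⊖ q`, and the sign
    -- is that of (-b)(-a).
    Ratio-invert {a = a} {p} {q} {r} a≉0 Lq (pole {k} {b} ≡.refl Lr pos) e =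
      k , - b , -‿≉0 (0<*⇒≉0ʳ pos) ,
      lead-resp (+-identityˡ _) (≋-sym (⊕-solve e)) (lead-⊕ (lead-pred (lead-⊛ lead-X Lq)) (lead-⊖ Lr)) ,
      regular 0# (⊖ q) (≋-trans (𝒫.-‿inverseʳ q) (≋-sym (≋-trans (C-⊛ 0# p) (·-zero p)))) (lead-⊖ Lq)
        (<-respʳ (sym (trans (-a*-b≈a*b b a) (*-comm b a))) pos)
    Ratio-invert {K} {a} {p} {q} {r} a≉0 Lq (regular {d} γ z e′ Lz nonneg) e = cases
      where
      -- `ε` is the value of x - r / q at θ, and p = ε q + y with `y` = (x - θ) q + z. So q / p has
      -- a pole if `ε` is 0 and the value 1 / ε otherwise.
      ε = θ + - γ
      y = f ⊛ q ⊕ z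

      Ly : Lead (suc K) (a + d) y
      Ly = lead-⊕ (lead-f⊛ Lq) Lz

      pos : 0# < a * (a + d)
      pos = <-respʳ (sym (distribˡ a a d)) (+-pos-nonNeg (square-pos a≉0) nonneg)

      p≋ : p ≋ C ε ⊛ q ⊕ y
      p≋ = 𝒫-Ring.+-cancelʳ r _ _ (begin
        p ⊕ r                                   ≈⟨ e ⟩
        X ⊛ q                                   ≈⟨ ⊛-cong X≋f⊕Cθ ≋-refl ⟩
        (f ⊕ C θ) ⊛ q                           ≈⟨ ⊛-cong (⊕-cong (≋-refl {f}) Cθ≋) ≋-refl ⟩
        (f ⊕ (C ε ⊕ C γ)) ⊛ q                   ≈⟨ solve 4 (λ f e g q → (f :+ (e :+ g)) :* q := (e :* q :+ f :* q) :+ g :* q) ≋-refl f (C ε) (C γ) q ⟩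
        (C ε ⊛ q ⊕ f ⊛ q) ⊕ C γ ⊛ q             ≈⟨ ⊕-cong (≋-refl {C ε ⊛ q ⊕ f ⊛ q}) e′ ⟨
        (C ε ⊛ q ⊕ f ⊛ q) ⊕ (r ⊕ z)             ≈⟨ solve 4 (λ a b r z → (a :+ b) :+ (r :+ z) := (a :+ (b :+ z)) :+ r) ≋-refl (C ε ⊛ q) (f ⊛ q) r z ⟩
        (C ε ⊛ q ⊕ y) ⊕ r                       ∎)
        where
        open 𝒫-Reasoning
        open 𝒫-Solver
        Cθ≋ : C θ ≋ C ε ⊕ C γ
        Cθ≋ = ∷≈∷ (sym (trans (+-assoc θ (- γ) γ) (trans (+-congˡ (-‿inverseˡ γ)) (+-identityʳ θ)))) []≈[]

      cases : ∃₂ λ K′ a′ → ¬ (a′ ≈ 0#) × Lead K′ a′ p × Ratio Positive K′ a′ p q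
      zeroCase : ε ≈ 0# → ∃₂ λ K′ a′ → ¬ (a′ ≈ 0#) × Lead K′ a′ p × Ratio Positive K′ a′ p q
      nonzeroCase : ¬ (ε ≈ 0#) → ∃₂ λ K′ a′ → ¬ (a′ ≈ 0#) × Lead K′ a′ p × Ratio Positive K′ a′ p q

      zeroCase ε≈0 = suc K , a + d , 0<*⇒≉0ʳ pos ,
        lead-resp refl (≋-sym (≋-trans p≋ (⊕-zeroˡ y (⊛-cong (∷≈[] ε≈0 []≈[]) (≋-refl {q}))))) Ly ,
        pole ≡.refl Lq (<-respʳ (*-comm a (a + d)) pos)

      nonzeroCase ε≉0 with inverse ε ε≉0
      ... | ε⁻¹ , εε⁻¹≈1 = K , ε * a , *-≉0 ε≉0 a≉0 ,
        lead-resp (+-identityʳ _) (≋-sym p≋) (lead-⊕ (lead-⊛ (lead-C ε) Lq) (lead-pred Ly)) ,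
        regular ε⁻¹ (C ε⁻¹ ⊛ y) (begin
          q ⊕ C ε⁻¹ ⊛ y                        ≈⟨ ⊕-congˡ (C ε⁻¹ ⊛ y) (⊛-identityˡ q) ⟨
          C 1# ⊛ q ⊕ C ε⁻¹ ⊛ y                 ≈⟨ ⊕-congˡ (C ε⁻¹ ⊛ y) (⊛-cong C1≋ (≋-refl {q})) ⟩
          (C ε⁻¹ ⊛ C ε) ⊛ q ⊕ C ε⁻¹ ⊛ y        ≈⟨ solve 4 (λ i e q y → (i :* e) :* q :+ i :* y := i :* (e :* q :+ y)) ≋-refl (C ε⁻¹) (C ε) q y ⟩
          C ε⁻¹ ⊛ (C ε ⊛ q ⊕ y)                ≈⟨ ⊛-congʳ (C ε⁻¹) p≋ ⟨
          C ε⁻¹ ⊛ p                            ∎)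
          (lead-⊛ (lead-C ε⁻¹) Ly)
          (<-respʳ (sym (trans
            (*-interchange ε a ε⁻¹ (a + d))
            (trans (*-congʳ εε⁻¹≈1) (*-identityˡ _)))) pos)
        where
        open 𝒫-Reasoning
        open 𝒫-Solver
        C1≋ : C 1# ≋ C ε⁻¹ ⊛ C ε
        C1≋ = ≋-sym (≋-trans (C-⊛ ε⁻¹ (C ε)) (∷≈∷ (trans (*-comm ε⁻¹ ε) εε⁻¹≈1) []≈[]))

      cases with compare ε 0#
      ... | tri< _ ε≉0 _ = nonzeroCase ε≉0
      ... | tri≈ _ ε≈0 _ = zeroCase ε≈0
      ... | tri> _ ε≉0 _ = nonzeroCase ε≉0

    -- A pole lowers the order by one, a nonzero value keeps it, and a zero value raises it by
    -- exactly one since the derivative is not 0.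
    Ratio⇒order : ∀ {K a p q} → ¬ (a ≈ 0#) → Lead K a p → Ratio Positive K a p q →
      ∃ λ l → HasOrder l q × l ℕ.≤ suc K × K ℕ.≤ suc l
    Ratio⇒order a≉0 Lp (pole {k} {b} ≡.refl Lq pos) =
      k , (b , 0<*⇒≉0ʳ pos , Lq) , ℕ.m≤n⇒m≤1+n (ℕ.n≤1+n k) , ℕ.≤-refl
    Ratio⇒order {K} {a} {p} {q} a≉0 Lp (regular {d} γ z e Lz pos) with compare γ 0#
    ... | tri< _ γ≉0 _ = K , (γ * a , *-≉0 γ≉0 a≉0 , regular-lead Lp e Lz) , ℕ.n≤1+n K , ℕ.n≤1+n K
    ... | tri> _ γ≉0 _ = K , (γ * a , *-≉0 γ≉0 a≉0 , regular-lead Lp e Lz) , ℕ.n≤1+n K , ℕ.n≤1+n K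
    ... | tri≈ _ γ≈0 _ = suc K , (- d , -‿≉0 (0<*⇒≉0ʳ pos) , lead-resp refl (≋-sym q≋) (lead-⊖ Lz)) ,
                         ℕ.≤-refl , ℕ.m≤n⇒m≤1+n (ℕ.n≤1+n K)
      where
      q≋ : q ≋ ⊖ z
      q≋ = ≋-trans (⊕-solve e) (⊕-zeroˡ (⊖ z) (≋-trans (⊛-cong (∷≈[] γ≈0 []≈[]) (≋-refl {p})) []≈[]))

    -- A nonzero square has even order and positive leading coefficient, and positive leading
    -- coefficients do not cancel, so the lowest order survives in the sum. Positivity is carried
    -- along for the case of equal orders.
    SumOfSquares-even : ∀ {p} → SumOfSquares p → p ≋ [] ⊎ ∃₂ λ m a → 0# < a × Lead (m ℕ.+ m) a p
    SumOfSquares-even sos-zero = inj₁ []≈[]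
    SumOfSquares-even (sos-resp e S) with SumOfSquares-even S
    ... | inj₁ p≋0                = inj₁ (≋-trans (≋-sym e) p≋0)
    ... | inj₂ (m , a , 0<a , L)  = inj₂ (m , a , 0<a , lead-resp refl e L)
    SumOfSquares-even (sos-square q {r} S) with zero-or-order q | SumOfSquares-even S
    ... | inj₁ q≋0 | inj₁ r≋0 = inj₁ (≋-trans (⊕-zeroˡ r (⊛-cong q≋0 (≋-refl {q}))) r≋0)
    ... | inj₁ q≋0 | inj₂ (m , a , 0<a , L) =
      inj₂ (m , a , 0<a , lead-resp refl (≋-sym (⊕-zeroˡ r (⊛-cong q≋0 (≋-refl {q})))) L)
    ... | inj₂ (j , b , b≉0 , L) | inj₁ r≋0 =
      inj₂ (j , b * b , square-pos b≉0 , lead-resp refl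
        (≋-sym (≋-trans (⊕-cong (≋-refl {q ⊛ q}) r≋0) (⊕-identityʳ (q ⊛ q)))) (lead-⊛ L L))
    ... | inj₂ (j , b , b≉0 , L) | inj₂ (m , a , 0<a , L′) with ℕ.<-cmp (j ℕ.+ j) (m ℕ.+ m)
    ...   | tri< lt _ _ = inj₂ (j , b * b , square-pos b≉0 ,
            lead-resp (+-identityʳ _) ≋-refl (lead-⊕ (lead-⊛ L L) (lead-< lt L′)))
    ...   | tri≈ _ eq _ = inj₂ (m , b * b + a , +-pos (square-pos b≉0) 0<a ,
            lead-⊕ (≡.subst (λ i → Lead i (b * b) (q ⊛ q)) eq (lead-⊛ L L)) L′)
    ...   | tri> _ _ gt = inj₂ (m , a , 0<a ,
            lead-resp (+-identityˡ _) ≋-refl (lead-⊕ (lead-< gt (lead-⊛ L L)) L′))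

    even≢odd : ∀ m j → m ℕ.+ m ≢ suc (j ℕ.+ j)
    even≢odd (suc m) (suc j) eq = even≢odd m j (ℕ.suc-injective (ℕ.suc-injective
      (≡.trans (≡.sym (≡.cong suc (ℕ.+-suc m m))) (≡.trans eq (≡.cong (λ i → suc (suc i)) (ℕ.+-suc j j))))))
    even≢odd (suc m) zero eq with () ← ≡.trans (≡.sym (ℕ.+-suc m m)) (ℕ.suc-injective eq)

    -- `r` has order greater than `i + j`, so to lowest order the sum of squares is -p q, which is
    -- not zero and has the odd order `i + j`.
    no-odd-excess : ∀ {i j p q r} m → i ℕ.+ j ≡ suc (m ℕ.+ m) → HasOrder i p → HasOrder j q →
      Lead (i ℕ.+ j) 0# r → ¬ SumOfSquares-excess (p ⊛ q) r
    no-odd-excess {i} {j} {p} {q} {r} m odd (a , a≉0 , Lp) (b , b≉0 , Lq) Lr (t , sos , e) with SumOfSquares-even sos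
    ... | inj₁ t≋0 = *-≉0 a≉0 b≉0 (lead-unique (lead-⊛ Lp Lq)
            (lead-resp refl (≋-trans (≋-sym e) (⊕-zeroˡ (p ⊛ q) t≋0)) Lr))
    ... | inj₂ (m′ , d , 0<d , Lt) = even≢odd m′ m (≡.trans
            (order-unique (0<⇒≉0 0<d) (-‿≉0 (*-≉0 a≉0 b≉0)) Lt
              (lead-resp (+-identityˡ _) (≋-sym (⊕-solve e)) (lead-⊕ Lr (lead-⊖ (lead-⊛ Lp Lq)))))
            odd)

    HasOrder-⊕ : ∀ {k l p q} → k ℕ.< l → HasOrder k p → HasOrder l q → HasOrder k (p ⊕ q)
    HasOrder-⊕ k<l (a , a≉0 , L) (_ , _ , L′) =
      a , a≉0 , lead-resp (+-identityʳ a) ≋-refl (lead-⊕ L (lead-< k<l L′))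

    HasOrder-⊛-< : ∀ {i k l p q} → i ℕ.< k ℕ.+ l → HasOrder k p → HasOrder l q → Lead i 0# (p ⊛ q)
    HasOrder-⊛-< lt (_ , _ , L) (_ , _ , L′) = lead-< lt (lead-⊛ L L′)

    -- Multiplicities of θ in induced subgraphs

    module _ {n} (G : Graph n) where

      -- Order and leading coefficient belong to the conclusion: the induction on the size also
      -- proves that the polynomial is not zero. The values returned for different neighbours are
      -- identified by uniqueness.
      localRatio : ∀ k S u → ∣ S ∣ ≡ k → lookup S u ≡ true →
        ∃₂ λ K a → ¬ (a ≈ 0#) × Lead K a (μ ℝ G S) × Ratio Positive K a (μ ℝ G S) (μ ℝ G (S ⊝ u))
      localRatio zero    S u size Su = contradiction (≡.trans (≡.sym size) (∣delete∣ S u Su)) λ ()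
      localRatio (suc k) S u size Su = Ratio-invert (proj₁ (proj₂ (proj₂ order))) Lq
        (Ratio-sum Lq (λ v → adj G u v ∧ lookup T v) (λ v → μ ℝ G (T ⊝ v)) neighbour) (μ-recurrence G S u Su)
        where
        T = S ⊝ u
        size′ : ∣ T ∣ ≡ k
        size′ = ≡.sym (ℕ.suc-injective (≡.trans (≡.sym size) (∣delete∣ S u Su)))
        order : ∃₂ λ K a → ¬ (a ≈ 0#) × Lead K a (μ ℝ G T)
        order with empty-or-member T
        ... | inj₁ none = 0 , 1# , 0<⇒≉0 0<1 , lead-resp refl (≋-sym (μ-empty G T none)) (lead-C 1#)
        ... | inj₂ (w , Tw) with K , a , a≉0 , L , _ ← localRatio k T w size′ Tw = K , a , a≉0 , L
        Lq = proj₂ (proj₂ (proj₂ order))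
        neighbour : ∀ v → adj G u v ∧ lookup T v ≡ true →
          Ratio NonNegative (proj₁ order) (proj₁ (proj₂ order)) (μ ℝ G T) (μ ℝ G (T ⊝ v))
        neighbour v isNbr with adj G u v
        ... | true with K , a , a≉0 , L , ratio ← localRatio k T v size′ isNbr
                   with ≡.refl ← order-unique a≉0 (proj₁ (proj₂ (proj₂ order))) L Lq =
          Ratio-weaken (lead-unique L Lq) ratio

      abstract
        order : ∀ S → ∃ λ k → HasOrder k (μ ℝ G S)
        order S with empty-or-member S
        ... | inj₁ none = 0 , 1# , 0<⇒≉0 0<1 , lead-resp refl (≋-sym (μ-empty G S none)) (lead-C 1#)
        ... | inj₂ (w , Sw) with K , a , a≉0 , L , _ ← localRatio ∣ S ∣ S w ≡.refl Sw = K , a , a≉0 , L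

      mult : Subset n → ℕ
      mult S = proj₁ (order S)

      hasMult : ∀ S → HasOrder (mult S) (μ ℝ G S)
      hasMult S = proj₂ (order S)

      hasMult-≡ : ∀ {S k} → mult S ≡ k → HasOrder k (μ ℝ G S)
      hasMult-≡ {S} ≡.refl = hasMult S

      interlacing : ∀ S u → lookup S u ≡ true → mult (S ⊝ u) ℕ.≤ suc (mult S) × mult S ℕ.≤ suc (mult (S ⊝ u))
      interlacing S u Su
        with K , a , a≉0 , L , ratio ← localRatio ∣ S ∣ S u ≡.refl Su
        with l , (b , b≉0 , L′) , upper , lower ← Ratio⇒order a≉0 L ratio
        with ≡.refl ← order-unique a≉0 (proj₁ (proj₂ (hasMult S))) L (proj₂ (proj₂ (hasMult S)))
        with ≡.refl ← order-unique b≉0 (proj₁ (proj₂ (hasMult (S ⊝ u)))) L′ (proj₂ (proj₂ (hasMult (S ⊝ u))))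
        = upper , lower

      -- Interlacing leaves two other values for the multiplicity of the triple,
      -- and each of them makes a sum of squares vanish to odd order.
      triple : ∀ S u v w → lookup S u ≡ true → lookup S v ≡ true → lookup S w ≡ true → u ≢ v → u ≢ w → v ≢ w →
        mult (S ⊝ u) ≡ 1 ℕ.+ mult S → mult (S ⊝ v) ≡ 1 ℕ.+ mult S → mult (S ⊝ w) ≡ 1 ℕ.+ mult S →
        mult (S ⊝ u ⊝ v) ≡ 2 ℕ.+ mult S → mult (S ⊝ w ⊝ u) ≡ 2 ℕ.+ mult S → mult (S ⊝ w ⊝ v) ≡ 2 ℕ.+ mult S →
        mult (S ⊝ w ⊝ u ⊝ v) ≡ 3 ℕ.+ mult S
      triple S u v w Su Sv Sw u≢v u≢w v≢w mu mv mw muv mwu mwv = decide (ℕ.m≤n⇒m<n∨m≡n upper)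
        where
        k = mult S
        W = S ⊝ w
        j = mult (W ⊝ u ⊝ v)
        Wu : lookup W u ≡ true
        Wu = ≡.trans (⊝-kept S u≢w) Su
        Wv : lookup W v ≡ true
        Wv = ≡.trans (⊝-kept S v≢w) Sv
        Wuv : lookup (W ⊝ u) v ≡ true
        Wuv = ≡.trans (⊝-kept W (u≢v ∘ ≡.sym)) Wv

        upper : j ℕ.≤ 3 ℕ.+ k
        upper = ≡.subst (λ i → j ℕ.≤ suc i) mwu (proj₁ (interlacing (W ⊝ u) v Wuv))
        lower : 1 ℕ.+ k ℕ.≤ j
        lower = ℕ.≤-pred (≡.subst (ℕ._≤ suc j) mwu (proj₂ (interlacing (W ⊝ u) v Wuv)))

        -- In `W` the orders would be (k+1) + (k+2) = 2(k+1) + 1 against (k+2) + (k+2).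
        not-2 : j ≢ 2 ℕ.+ k
        not-2 j≡ = no-odd-excess (1 ℕ.+ k) (≡.cong suc (ℕ.+-suc k (suc k))) (hasMult-≡ mw) (hasMult-≡ j≡)
          (HasOrder-⊛-< (ℕ.n<1+n _) (hasMult-≡ mwu) (hasMult-≡ mwv))
          (rayleigh (adj G) (λ _ → X) (μ ℝ G) (μ-recurrence G) ∣ W ∣ W u v ≡.refl Wu Wv u≢v)

        Suv⊝w : S ⊝ u ⊝ v ⊝ w ≡ W ⊝ u ⊝ v
        Suv⊝w = ≡.trans (⊝-comm (S ⊝ u) v≢w) (≡.cong (_⊝ v) (⊝-comm S u≢w))

        perturbed : Subset n → Poly ℝ
        perturbed = perturb (μ ℝ G) w

        perturbed-order : ∀ T {i l} → lookup T w ≡ true → HasOrder i (μ ℝ G T) → HasOrder l (μ ℝ G (T ⊝ w)) →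
          i ℕ.< l → HasOrder i (perturbed T)
        perturbed-order T Tw Hi Hl i<l rewrite Tw = HasOrder-⊕ i<l Hi Hl

        Suw : ∀ {x} → x ≢ w → lookup (S ⊝ x) w ≡ true
        Suw x≢w = ≡.trans (⊝-kept S (x≢w ∘ ≡.sym)) Sw

        not-1 : j ≢ 1 ℕ.+ k
        not-1 j≡ = no-odd-excess k (ℕ.+-suc k k)
          (perturbed-order S Sw (hasMult S) (hasMult-≡ mw) ℕ.≤-refl)
          perturbed-uv
          (HasOrder-⊛-< ℕ.≤-refl
            (perturbed-order (S ⊝ u) (Suw u≢w) (hasMult-≡ mu) (hasMult-≡ (≡.trans (≡.cong mult (⊝-comm S u≢w)) mwu)) ℕ.≤-refl)
            (perturbed-order (S ⊝ v) (Suw v≢w) (hasMult-≡ mv) (hasMult-≡ (≡.trans (≡.cong mult (⊝-comm S v≢w)) mwv)) ℕ.≤-refl))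
          (rayleigh (adj G) (perturbedWeight (λ _ → X) w) perturbed
            (perturb-recurrence (adj G) (λ _ → X) (μ ℝ G) (μ-recurrence G) w) ∣ S ∣ S u v ≡.refl Su Sv u≢v)
          where
          -- Here alone the summand with `w` deleted dominates, with order k+1 against k+2;
          -- `HasOrder-⊕` expects the lower order first, hence the swap.
          perturbed-uv : HasOrder (1 ℕ.+ k) (perturbed (S ⊝ u ⊝ v))
          perturbed-uv rewrite ≡.trans (⊝-kept (S ⊝ u) (v≢w ∘ ≡.sym)) (Suw u≢w)
            with b , b≉0 , L ← HasOrder-⊕ ℕ.≤-refl (hasMult-≡ (≡.trans (≡.cong mult Suv⊝w) j≡)) (hasMult-≡ muv) =
            b , b≉0 , lead-resp refl (⊕-comm (μ ℝ G (S ⊝ u ⊝ v ⊝ w)) (μ ℝ G (S ⊝ u ⊝ v))) L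

        decide : j ℕ.< 3 ℕ.+ k ⊎ j ≡ 3 ℕ.+ k → j ≡ 3 ℕ.+ k
        decide (inj₂ j≡) = j≡
        decide (inj₁ j<) with ℕ.m≤n⇒m<n∨m≡n (ℕ.≤-pred j<)
        ... | inj₂ j≡2 = contradiction j≡2 not-2
        ... | inj₁ j<2 = contradiction (ℕ.≤-antisym (ℕ.≤-pred j<2) lower) not-1

      -- Deleting a set vertex by vertex

      mult-Removes-≤ : ∀ m S Y S′ → ∣ Y ∣ ≡ m → Includes S Y → Removes S Y S′ → mult S′ ℕ.≤ mult S ℕ.+ m
      mult-Removes-≤ m S Y S′ size inc rem with empty-or-member Y
      ... | inj₁ none = ≡.subst (λ T → mult T ℕ.≤ mult S ℕ.+ m) (≡.sym (Removes-none S Y S′ none rem)) (ℕ.m≤m+n (mult S) m)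
      ... | inj₂ (w , Yw) with m | ≡.trans (≡.sym size) (∣delete∣ Y w Yw)
      ...   | suc m′ | size′ = ℕ.≤-trans
        (mult-Removes-≤ m′ (S ⊝ w) (Y ⊝ w) S′ (≡.sym (ℕ.suc-injective size′)) (Includes-⊝ S Y w inc) (Removes-⊝ S Y S′ w Yw rem))
        (ℕ.≤-trans (ℕ.+-monoˡ-≤ m′ (proj₁ (interlacing S w (inc w Yw)))) (ℕ.≤-reflexive (≡.sym (ℕ.+-suc (mult S) m′))))

      -- `Pairs` says nothing about a set with a single member, and the induction reaches such sets,
      -- so `Singles` is carried beside it.
      Singles Pairs : Subset n → Subset n → Set
      Singles S Y = ∀ u → lookup Y u ≡ true → mult (S ⊝ u) ≡ 1 ℕ.+ mult S
      Pairs   S Y = ∀ u v → lookup Y u ≡ true → lookup Y v ≡ true → u ≢ v → mult (S ⊝ u ⊝ v) ≡ 2 ℕ.+ mult S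

      -- Both hypotheses pass to `S ⊝ w` and `Y ⊝ w`: a single there is a pair with `w`, and a pair
      -- there is a triple with `w`, which `triple` settles.
      mult-Removes : ∀ m S Y S′ → ∣ Y ∣ ≡ m → Includes S Y → Removes S Y S′ → Singles S Y → Pairs S Y →
        mult S′ ≡ mult S ℕ.+ m
      mult-Removes m S Y S′ size inc rem single pair with empty-or-member Y
      ... | inj₁ none = ≡.trans (≡.cong mult (Removes-none S Y S′ none rem)) (≡.trans (≡.sym (ℕ.+-identityʳ (mult S)))
        (≡.cong (mult S ℕ.+_) (≡.trans (≡.sym (∣empty∣ Y none)) size)))
      ... | inj₂ (w , Yw) with m | ≡.trans (≡.sym size) (∣delete∣ Y w Yw)
      ...   | suc m′ | size′ = ≡.trans
        (mult-Removes m′ (S ⊝ w) (Y ⊝ w) S′ (≡.sym (ℕ.suc-injective size′)) (Includes-⊝ S Y w inc) (Removes-⊝ S Y S′ w Yw rem) single′ pair′)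
        (≡.trans (≡.cong (ℕ._+ m′) (single w Yw)) (≡.sym (ℕ.+-suc (mult S) m′)))
        where
        single′ : Singles (S ⊝ w) (Y ⊝ w)
        single′ u Yu with u≢w , Yu ← ∈-⊝ Y Yu =
          ≡.trans (pair w u Yw Yu (u≢w ∘ ≡.sym)) (≡.cong suc (≡.sym (single w Yw)))
        pair′ : Pairs (S ⊝ w) (Y ⊝ w)
        pair′ u v Yu Yv u≢v with u≢w , Yu ← ∈-⊝ Y Yu | v≢w , Yv ← ∈-⊝ Y Yv =
          ≡.trans (triple S u v w (inc u Yu) (inc v Yv) (inc w Yw) u≢v u≢w v≢w
                    (single u Yu) (single v Yv) (single w Yw)
                    (pair u v Yu Yv u≢v) (pair w u Yw Yu (u≢w ∘ ≡.sym)) (pair w v Yw Yv (v≢w ∘ ≡.sym)))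
                  (≡.cong (2 ℕ.+_) (≡.sym (single w Yw)))

      -- The two implications

      multiplicity : ∀ S → Mult ℝ θ (μ ℝ G S) (mult S)
      multiplicity S = HasOrder⇒Mult (hasMult S)

      multiplicity-unique : ∀ S k → Mult ℝ θ (μ ℝ G S) k → mult S ≡ k
      multiplicity-unique S k = HasOrder-Mult-unique {mult S} {k} {μ ℝ G S} (hasMult S)

      -- The `m` members of `Y` other than `u` and `v` raise the multiplicity by at most `m` of the
      -- total m + 2, so `u` and `v` together raise it by at least 2, and by interlacing by at most
      -- 2.
      extreme⇒nice : ∀ Y → IsExtreme ℝ G θ Y → IsNice ℝ G θ Y
      extreme⇒nice Y (k , full , removed) u v u∈Y v∈Y u≢v
        with ≡.refl ← multiplicity-unique Full k full =
        mult Full , multiplicity Full ,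
        ≡.subst (λ S → Mult ℝ θ (μ ℝ G S) (mult Full ℕ.+ 2)) (≡.sym (∁-pair u v))
          (≡.subst (Mult ℝ θ (μ ℝ G (Full ⊝ u ⊝ v))) (≡.trans (ℕ.≤-antisym upper lower) (ℕ.+-comm 2 (mult Full))) (multiplicity (Full ⊝ u ⊝ v)))
        where
        Yu : lookup Y u ≡ true
        Yu = []=⇒lookup u∈Y
        Yv : lookup (Y ⊝ u) v ≡ true
        Yv = ≡.trans (⊝-kept Y (u≢v ∘ ≡.sym)) ([]=⇒lookup v∈Y)
        m = ∣ Y ⊝ u ⊝ v ∣
        size : ∣ Y ∣ ≡ 2 ℕ.+ m
        size = ≡.trans (∣delete∣ Y u Yu) (≡.cong suc (∣delete∣ (Y ⊝ u) v Yv))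
        upper : mult (Full ⊝ u ⊝ v) ℕ.≤ 2 ℕ.+ mult Full
        upper = ℕ.≤-trans (proj₁ (interlacing (Full ⊝ u) v (Includes-⊝ Full Y u (Full-includes Y) v Yv)))
                          (s≤s (proj₁ (interlacing Full u (Full-includes Y u Yu))))
        lower : 2 ℕ.+ mult Full ℕ.≤ mult (Full ⊝ u ⊝ v)
        lower = ℕ.+-cancelʳ-≤ m _ _ (ℕ.≤-trans (ℕ.≤-reflexive sizes)
          (mult-Removes-≤ m (Full ⊝ u ⊝ v) (Y ⊝ u ⊝ v) (∁ Y) ≡.refl
            (Includes-⊝ (Full ⊝ u) (Y ⊝ u) v (Includes-⊝ Full Y u (Full-includes Y)))
            (Removes-⊝ (Full ⊝ u) (Y ⊝ u) (∁ Y) v Yv (Removes-⊝ Full Y (∁ Y) u Yu (∁-removes Y)))))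
          where
          sizes : 2 ℕ.+ mult Full ℕ.+ m ≡ mult (∁ Y)
          sizes = ≡.sym (≡.trans (multiplicity-unique (∁ Y) (mult Full ℕ.+ ∣ Y ∣) removed)
            (≡.trans (≡.cong (mult Full ℕ.+_) size)
              (≡.trans (≡.sym (ℕ.+-assoc (mult Full) 2 m)) (≡.cong (ℕ._+ m) (ℕ.+-comm (mult Full) 2)))))

      nice⇒extreme : ∀ Y → 1 ℕ.< ∣ Y ∣ → IsNice ℝ G θ Y → IsExtreme ℝ G θ Y
      nice⇒extreme Y 1<∣Y∣ nice = mult Full , multiplicity Full ,
        ≡.subst (Mult ℝ θ (μ ℝ G (∁ Y)))
          (mult-Removes ∣ Y ∣ Full Y (∁ Y) ≡.refl (Full-includes Y) (∁-removes Y) single pair) (multiplicity (∁ Y))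
        where
        -- Each pair comes with its own `k`; uniqueness of the multiplicity makes all of them equal
        -- to `mult Full`.
        pair : Pairs Full Y
        pair u v Yu Yv u≢v
          with k , full , removed ← nice u v (lookup⇒[]= u Y Yu) (lookup⇒[]= v Y Yv) u≢v
          rewrite ∁-pair u v
          with ≡.refl ← multiplicity-unique Full k full =
          ≡.trans (multiplicity-unique (Full ⊝ u ⊝ v) (mult Full ℕ.+ 2) removed) (ℕ.+-comm (mult Full) 2)

        -- As `Y` has more than one element there is a second member `v`; deleting it accounts for
        -- at most 1 of the gain of 2, so deleting `u` gains at least 1.
        single : Singles Full Y
        single u Yu with empty-or-member (Y ⊝ u)
        ... | inj₁ none = contradiction (≡.subst (1 ℕ.<_) (≡.trans (∣delete∣ Y u Yu) (≡.cong suc (∣empty∣ (Y ⊝ u) none))) 1<∣Y∣) (ℕ.<-irrefl ≡.refl)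
        ... | inj₂ (v , Yv′) with v≢u , Yv ← ∈-⊝ Y Yv′ = ℕ.≤-antisym
          (proj₁ (interlacing Full u (Full-includes Y u Yu)))
          (ℕ.≤-pred (≡.subst (ℕ._≤ suc (mult (Full ⊝ u))) (pair u v Yu Yv (v≢u ∘ ≡.sym))
            (proj₁ (interlacing (Full ⊝ u) v (Includes-⊝ Full Y u (Full-includes Y) v Yv′)))))

open RealPolynomials using (extreme⇒nice; nice⇒extreme)
open import Data.Nat using (_<_)

theorem3p15 : ∀ {c ℓ} (ℝ : RealNumbers c ℓ) {n : ℕ} (G : Graph n)
                (θ : RealNumbers.Carrier ℝ) (X : Subset n) →
                1 < ∣ X ∣ →
                IsExtreme ℝ G θ X ⇔ IsNice ℝ G θ X
theorem3p15 ℝ G θ X 1<∣X∣ = mk⇔ (extreme⇒nice ℝ θ G X) (nice⇒extreme ℝ θ G X 1<∣X∣)
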